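{- There is a polynomial-time algorithm which, for any CBGT instance $(E,\mathcal{I},g)$ where $(E,\mathcal{I})$ is a partition matroid, implements an infinite valid schedule $\pi$ of height at most $2$, i.e. $h(\pi)\le 2$.
   Context: An instance of Combinatorial Bamboo Garden Trimming (CBGT) is a triple $(E,\mathcal{I},g)$ where $E$ is a finite set (of "bamboos"), $\mathcal{I}\subseteq 2^E$ is a family of subsets of $E$, and $g\in\mathbb{Q}_{\ge 0}^E$ is a vector of growth rates such that there are coefficients $\lambda(I)\ge 0$ ($I\in\mathcal{I}$) with $\sum_{I\in\mathcal{I}}\lambda(I)=1$ and $g(e)=\sum_{I\in\mathcal{I}:\, e\in I}\lambda(I)$ for every $e\in E$. Let $\mathbb{N}=\{1,2,\dots\}$. An infinite schedule is a sequence $\pi=\pi(1),\pi(2),\dots$ of subsets of $E$; it is valid if $\pi(t)\in\mathcal{I}$ for all $t\in\mathbb{N}$. $h^\pi_t(e)$ denotes the height of $e$ on day $t$ after growing but before $\pi(t)$ is cut, i.e. $h^\pi_1(e)=g(e)$, and $h^\pi_{t+1}(e)=g(e)$ if $e\in\pi(t)$, $h^\pi_{t+1}(e)=h^\pi_t(e)+g(e)$ otherwise. The height of $\pi$ is $h(\pi)=\max_{e\in E}\sup_{t\in\mathbb{N}}h^\pi_t(e)$. A partition matroid is a direct sum of uniform matroids: $E$ is partitioned into $E_1,\dots,E_m$, there are integers $k_1,\dots,k_m$, and $\mathcal{I}=\{I\subseteq E : |I\cap E_j|\le k_j \text{ for all } j\}$; it is given to the algorithm by the $E_j$ and $k_j$.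 An algorithm implements $\pi$ if it outputs $\pi(1),\pi(2),\dots$ one step at a time; polynomial time means that preprocessing and the computation of each next set take time polynomial in the input size. -}

module Defs where

open import Data.Bool using (Bool; true; false)
open import Data.Fin using (Fin)
import Data.Fin.Properties as Fin
open import Data.Fin.Subset using (Subset; inside; outside; _∈_; _∩_; ∣_∣)
open import Data.Fin.Subset.Properties using (_∈?_)
open import Data.Integer as ℤ using (ℤ; +_; -[1+_])
open import Data.List using (List; []; _∷_; [_]; _++_; map; filter; foldr; tabulate)
open import Data.Nat as ℕ using (ℕ; zero; suc)
open import Data.Nat.Binary as ℕᵇ using (ℕᵇ; 2[1+_]; 1+[2_])
open import Data.Product using (∃!)
open import Data.Rational as ℚ using (ℚ; 0ℚ; 1ℚ; ↥_; ↧ₙ_)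
open import Data.Vec as Vec using (Vec; []; _∷_)
open import Level using (0ℓ)
open import Relation.Binary.PropositionalEquality using (_≡_)
open import Relation.Nullary using (yes; no)
open import Relation.Unary using (Pred; Decidable)

------------------------------------------------------------------------
-- Combinatorial Bamboo Garden Trimming, with E = Fin n

sumℚ : List ℚ → ℚ
sumℚ = foldr ℚ._+_ 0ℚ

-- Every subset of Fin n, exactly once.
subsets : ∀ n → List (Subset n)
subsets zero    = [ [] ]
subsets (suc n) = map (inside ∷_) (subsets n) ++ map (outside ∷_) (subsets n)

-- A family 𝓘 ⊆ 2^E is a predicate on subsets; decidability is only used to
-- form the finite sums over the members of 𝓘.
record IsCBGT {n} {𝓘 : Pred (Subset n) 0ℓ} (𝓘? : Decidable 𝓘) (g : Fin n → ℚ) : Set where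
  members : List (Subset n)
  members = filter 𝓘? (subsets n)

  field
    g-nonNeg : ∀ e → 0ℚ ℚ.≤ g e
    coeff    : Subset n → ℚ
    λ-nonNeg : ∀ I → 𝓘 I → 0ℚ ℚ.≤ coeff I
    λ-sum    : sumℚ (map coeff members) ≡ 1ℚ
    λ-rate   : ∀ e → g e ≡ sumℚ (map coeff (filter (e ∈?_) members))

-- Days are numbered from 0 here: π t is the set cut on day t + 1.
Schedule : ℕ → Set
Schedule n = ℕ → Subset n

Valid : ∀ {n} → Pred (Subset n) 0ℓ → Schedule n → Set
Valid 𝓘 π = ∀ t → 𝓘 (π t)

-- height g π t e is the height of e on day t + 1, before π t is cut.
height : ∀ {n} → (Fin n → ℚ) → Schedule n → ℕ → Fin n → ℚ
height g π zero    e = g e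
height g π (suc t) e with e ∈? π t
... | yes _ = g e
... | no  _ = height g π t e ℚ.+ g e

-- h(π) ≤ c, where h(π) is the maximum over e of the supremum over t of the
-- heights: such a supremum is at most c iff c is an upper bound.
HeightAtMost : ∀ {n} → (Fin n → ℚ) → Schedule n → ℚ → Set
HeightAtMost g π c = ∀ e t → height g π t e ℚ.≤ c

------------------------------------------------------------------------
-- Partition matroids

record PartitionMatroid (n m : ℕ) : Set where
  field
    block       : Fin m → Subset n
    isPartition : ∀ e → ∃! _≡_ (λ j → e ∈ block j)
    capacity    : Fin m → ℤ

  Independent : Pred (Subset n) 0ℓ
  Independent I = ∀ j → + ∣ I ∩ block j ∣ ℤ.≤ capacity j

  independent? : Decidable Independent
  independent? I = Fin.all? (λ j → + ∣ I ∩ block j ∣ ℤ.≤? capacity j)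

open PartitionMatroid public

------------------------------------------------------------------------
-- Model of computation
--
-- A first-order, call-by-value functional language with general recursion
-- over binary trees (as LISP without atoms other than nil).  A program is a
-- finite table of mutually recursive functions.  Every evaluation rule costs
-- one unit.  As values are handled by reference, each rule is a bounded number
-- of operations of a pointer machine, so polynomial cost in this model is
-- polynomial time in the usual sense.

data Tree : Set where
  nil  : Tree
  cons : Tree → Tree → Tree

size : Tree → ℕ
size nil        = 1
size (cons u v) = suc (size u ℕ.+ size v)

-- Expr arity n: expressions with n free variables, which may call the
-- functions declared by arity.
data Expr {k} (arity : Fin k → ℕ) (n : ℕ) : Set where
  var  : Fin n → Expr arity n
  nil  : Expr arity n
  cons : Expr arity n → Expr arity n → Expr arity n
  case : Expr arity n → Expr arity n → Expr arity (2 ℕ.+ n) → Expr arity n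
  let′ : Expr arity n → Expr arity (suc n) → Expr arity n
  call : (f : Fin k) → Vec (Expr arity n) (arity f) → Expr arity n

record Program : Set where
  field
    numFuns : ℕ
    arity   : Fin numFuns → ℕ
    body    : (f : Fin numFuns) → Expr arity (arity f)

module Semantics (P : Program) where
  open Program P

  -- ρ ⊢ e ⇓ v ⟨ c ⟩: in environment ρ, e evaluates to v at cost c.
  infix 4 _⊢_⇓_⟨_⟩ _⊢_⇓*_⟨_⟩

  mutual
    data _⊢_⇓_⟨_⟩ {n} (ρ : Vec Tree n) : Expr arity n → Tree → ℕ → Set where
      var : ∀ {x} → ρ ⊢ var x ⇓ Vec.lookup ρ x ⟨ 1 ⟩
      nil : ρ ⊢ nil ⇓ nil ⟨ 1 ⟩
      cons : ∀ {e₁ e₂ v₁ v₂ c₁ c₂} →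
        ρ ⊢ e₁ ⇓ v₁ ⟨ c₁ ⟩ →
        ρ ⊢ e₂ ⇓ v₂ ⟨ c₂ ⟩ →
        ρ ⊢ cons e₁ e₂ ⇓ cons v₁ v₂ ⟨ suc (c₁ ℕ.+ c₂) ⟩
      case-nil : ∀ {e e₁ e₂ v c c₁} →
        ρ ⊢ e ⇓ nil ⟨ c ⟩ →
        ρ ⊢ e₁ ⇓ v ⟨ c₁ ⟩ →
        ρ ⊢ case e e₁ e₂ ⇓ v ⟨ suc (c ℕ.+ c₁) ⟩
      case-cons : ∀ {e e₁ e₂ u₁ u₂ v c c₂} →
        ρ ⊢ e ⇓ cons u₁ u₂ ⟨ c ⟩ →
        (u₁ ∷ u₂ ∷ ρ) ⊢ e₂ ⇓ v ⟨ c₂ ⟩ →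
        ρ ⊢ case e e₁ e₂ ⇓ v ⟨ suc (c ℕ.+ c₂) ⟩
      let′ : ∀ {e₁ e₂ u v c₁ c₂} →
        ρ ⊢ e₁ ⇓ u ⟨ c₁ ⟩ →
        (u ∷ ρ) ⊢ e₂ ⇓ v ⟨ c₂ ⟩ →
        ρ ⊢ let′ e₁ e₂ ⇓ v ⟨ suc (c₁ ℕ.+ c₂) ⟩
      call : ∀ {f es us v c c′} →
        ρ ⊢ es ⇓* us ⟨ c ⟩ →
        us ⊢ body f ⇓ v ⟨ c′ ⟩ →
        ρ ⊢ call f es ⇓ v ⟨ suc (c ℕ.+ c′) ⟩

    data _⊢_⇓*_⟨_⟩ {n} (ρ : Vec Tree n) :
           ∀ {l} → Vec (Expr arity n) l → Vec Tree l → ℕ → Set where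
      []  : ρ ⊢ [] ⇓* [] ⟨ 0 ⟩
      _∷_ : ∀ {l e v c c′} {es : Vec (Expr arity n) l} {vs} →
        ρ ⊢ e ⇓ v ⟨ c ⟩ →
        ρ ⊢ es ⇓* vs ⟨ c′ ⟩ →
        ρ ⊢ (e ∷ es) ⇓* (v ∷ vs) ⟨ c ℕ.+ c′ ⟩

------------------------------------------------------------------------
-- Encoding of inputs and outputs; numbers are written in binary

⌜_⌝bool : Bool → Tree
⌜ false ⌝bool = nil
⌜ true  ⌝bool = cons nil nil

⌜_⌝list : List Tree → Tree
⌜_⌝list = foldr cons nil

⌜_⌝subset : ∀ {n} → Subset n → Tree
⌜ p ⌝subset = ⌜ map ⌜_⌝bool (Vec.toList p) ⌝list

-- ℕᵇ is bijective base 2, least significant digit first.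
⌜_⌝ℕᵇ : ℕᵇ → Tree
⌜ ℕᵇ.zero  ⌝ℕᵇ = nil
⌜ 2[1+ b ] ⌝ℕᵇ = cons ⌜ true  ⌝bool ⌜ b ⌝ℕᵇ
⌜ 1+[2 b ] ⌝ℕᵇ = cons ⌜ false ⌝bool ⌜ b ⌝ℕᵇ

⌜_⌝ℕ : ℕ → Tree
⌜ a ⌝ℕ = ⌜ ℕᵇ.fromℕ a ⌝ℕᵇ

⌜_⌝ℤ : ℤ → Tree
⌜ + a      ⌝ℤ = cons ⌜ false ⌝bool ⌜ a ⌝ℕ
⌜ -[1+ a ] ⌝ℤ = cons ⌜ true  ⌝bool ⌜ suc a ⌝ℕ

⌜_⌝ℚ : ℚ → Tree
⌜ q ⌝ℚ = cons ⌜ ↥ q ⌝ℤ ⌜ ↧ₙ q ⌝ℕ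

-- The list of the pairs (E_j , k_j), followed by the list of growth rates.
encode : ∀ {n m} → PartitionMatroid n m → (Fin n → ℚ) → Tree
encode M g = cons
  ⌜ tabulate (λ j → cons ⌜ block M j ⌝subset ⌜ capacity M j ⌝ℤ) ⌝list
  ⌜ tabulate (λ e → ⌜ g e ⌝ℚ) ⌝list

------------------------------------------------------------------------
-- Algorithms producing infinite schedules

-- preprocess maps the input to an initial memory state; next maps the current
-- state to a pair (set to cut today , new state).
record Algorithm : Set where
  field
    program    : Program
    preprocess : Expr (Program.arity program) 1
    next       : Expr (Program.arity program) 1

-- On the given input the algorithm outputs π step by step, spending at most
-- bound time units on preprocessing and on each single day.
record Implements {n} (A : Algorithm) (input : Tree) (π : Schedule n) (bound : ℕ) : Set where
  open Algorithm A
  open Semantics program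

  field
    state      : ℕ → Tree
    startCost  : ℕ
    start      : (input ∷ []) ⊢ preprocess ⇓ state 0 ⟨ startCost ⟩
    startBound : startCost ℕ.≤ bound
    stepCost   : ℕ → ℕ
    step       : ∀ t → (state t ∷ []) ⊢ next ⇓ cons ⌜ π t ⌝subset (state (suc t)) ⟨ stepCost t ⟩
    stepBound  : ∀ t → stepCost t ℕ.≤ bound

module Submission where

-- Replace each rate g(e) > 0 by the largest power 2^-a not exceeding it: cutting
-- e every 2^a days then keeps its height at most 2^a g(e) <= 2.  A bamboo with
-- exponent a is a leaf at depth a of a binary tree whose nodes serve their two
-- subtrees alternately.  Within a block such trees are assembled like a binary
-- counter: two subtrees of the same depth merge and are carried one level up.
-- A tree carried out of the counter has load exactly 1, one that remains has
-- positive load, and the rounded rates of a block sum to at most its capacity k;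
-- so the block has at most k such trees and at most k cuts per day.

open import Defs
import Algebra.Properties.CommutativeSemigroup as CommutativeSemigroup
open import Data.Bool using (Bool; true; false; _∨_; if_then_else_)
open import Data.Bool.Properties using (∨-assoc; ∨-comm; ∨-identityʳ)
open import Data.Empty using (⊥-elim)
open import Data.Fin using (Fin; toℕ; #_)
import Data.Fin.Properties as Fin
open import Data.Fin.Subset using (Subset; _∈_; _∩_; ∣_∣; ⊥)
open import Data.Fin.Subset.Properties using (_∈?_; ∣⊥∣≡0; ∩-zeroˡ)
open import Data.Integer as ℤ using (+_; -[1+_])
import Data.Integer.Properties as ℤ
open import Data.List using (List; []; _∷_; map; length; filter; tabulate)
open import Data.List.Membership.Propositional using (find; lose) renaming (_∈_ to _∈ᴸ_)
open import Data.List.Membership.Propositional.Properties using (∈-map⁺)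
open import Data.List.Properties using (length-map)
open import Data.List.Relation.Unary.All as All using (All; []; _∷_)
import Data.List.Relation.Unary.All.Properties as All
open import Data.List.Relation.Unary.Any using (Any; here; there)
open import Data.Maybe using (Maybe; just; nothing; maybe)
open import Data.Nat using (ℕ; zero; suc; _+_; _*_; _^_; _∸_; _⊔_; _≤_; _<_; _<?_; z≤n; s≤s; >-nonZero)
open import Data.Nat.Binary as ℕᵇ using (ℕᵇ; 2[1+_]; 1+[2_])
import Data.Nat.Binary.Properties as ℕᵇ
open import Data.Nat.Properties
open import Data.Product using (∃-syntax; _×_; _,_; proj₁; proj₂)
open import Data.Rational as ℚ using (ℚ; 0ℚ; 1ℚ; ½; ↥_; ↧ₙ_; mkℚ; _/_)
import Data.Rational.Properties as ℚ
open import Data.Rational.Solver using (module +-*-Solver)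
import Data.Rational.Unnormalised as ℚᵘ
import Data.Rational.Unnormalised.Properties as ℚᵘ
open import Data.Sum using (_⊎_; inj₁; inj₂)
open import Data.Vec as Vec using (Vec; []; _∷_; here; there)
open import Function using (_∘_; id)
open import Relation.Binary using (tri<; tri≈; tri>)
open import Relation.Binary.PropositionalEquality
open import Relation.Nullary using (yes; no; does)
open import Relation.Nullary.Decidable using (True; toWitness)

open CommutativeSemigroup +-commutativeSemigroup using () renaming (interchange to +-interchange)
open CommutativeSemigroup *-commutativeSemigroup using () renaming (interchange to *-interchange)

-- Trees of alternating service

-- Both facts about the rates come from the fractional decomposition of `g`: a single rate is part
-- of a total of 1, hence at most 1, and averaging |I ∩ E_j| ≤ k over the coefficients bounds the
-- rates of a block by k. Powers of 1/2 are chosen because equal shares then merge in pairs without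
-- remainder, so only one tree per block can carry a fractional load. The obstacle on the
-- algorithmic side is that a period 2^a may be exponential in the length of the input, so the
-- schedule cannot be tabulated, while a plain day counter would outgrow any fixed bound on the
-- daily cost. The state therefore consists of the trees themselves: serving the left child and then
-- swapping the children records whose turn is next. This changes neither the depth nor the number
-- of the trees nor the set of leaves in each, so one bound on time and one bound on the cuts in a
-- block hold for all days.

data Rotor : Set where
  idle : Rotor
  leaf : ℕ → Rotor
  node : Rotor → Rotor → Rotor

fired : Rotor → Maybe ℕ
fired idle       = nothing
fired (leaf i)   = just i
fired (node l r) = fired l

turn : Rotor → Rotor
turn idle       = idle
turn (leaf i)   = leaf i
turn (node l r) = node r (turn l)

-- Waits i t d w: some leaf i at depth d of t fires after w further turns.
data Waits (i : ℕ) : Rotor → ℕ → ℕ → Set where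
  root  : Waits i (leaf i) 0 0
  left  : ∀ {l r d w} → Waits i l d w → Waits i (node l r) (suc d) (2 * w)
  right : ∀ {l r d w} → Waits i r d w → Waits i (node l r) (suc d) (suc (2 * w))

waits-bound : ∀ {i t d w} → Waits i t d w → w < 2 ^ d
waits-bound root = s≤s z≤n
waits-bound (left p) = *-monoʳ-< 2 (waits-bound p)
waits-bound (right {d = d} {w = w} p) = begin-strict
  suc (2 * w)   <⟨ n<1+n _ ⟩
  2 + 2 * w     ≡⟨ *-suc 2 w ⟨
  2 * suc w     ≤⟨ *-monoʳ-≤ 2 (waits-bound p) ⟩
  2 * 2 ^ d     ∎
  where open ≤-Reasoning

data Turned (i : ℕ) (t : Rotor) (d : ℕ) : ℕ → Set where
  fires : ∀ {w} → fired t ≡ just i → suc w ≡ 2 ^ d → Waits i (turn t) d w → Turned i t d 0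
  rests : ∀ {w} → Waits i (turn t) d w → Turned i t d (suc w)

-- A right child only moves to the left, from wait 1 + 2w to 2w. A left child is turned and moves to
-- the right: 2(w + 1) becomes 1 + 2w, and if it fired, its new wait 2^d - 1 becomes 2^(d+1) - 1.
waits-turn : ∀ {i t d w} → Waits i t d w → Turned i t d w
waits-turn root = fires refl refl root
waits-turn (left {d = d} p) with waits-turn p
... | fires {w} eq full q = fires eq (trans (sym (*-suc 2 w)) (cong (2 *_) full)) (right q)
... | rests {w} q rewrite +-suc w (w + 0) = rests (right q)
waits-turn (right p) = rests (left p)

depth : Rotor → ℕ
depth idle       = 0
depth (leaf _)   = 0
depth (node l r) = suc (depth l ⊔ depth r)

depth-turn : ∀ t → depth (turn t) ≡ depth t
depth-turn idle       = refl
depth-turn (leaf _)   = refl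
depth-turn (node l r) =
  cong suc (trans (⊔-comm (depth r) _) (cong (_⊔ depth r) (depth-turn l)))

-- Counting the rotors that meet a set of bamboos

bit : Bool → ℕ
bit false = 0
bit true  = 1

touches : (ℕ → Bool) → Rotor → Bool
touches P idle       = false
touches P (leaf i)   = P i
touches P (node l r) = touches P l ∨ touches P r

touches-turn : ∀ P t → touches P (turn t) ≡ touches P t
touches-turn P idle       = refl
touches-turn P (leaf _)   = refl
touches-turn P (node l r) =
  trans (∨-comm (touches P r) _) (cong (_∨ touches P r) (touches-turn P l))

bit-mono-∨ˡ : ∀ a b → bit a ≤ bit (a ∨ b)
bit-mono-∨ˡ false b = z≤n
bit-mono-∨ˡ true  b = ≤-refl

touches-fired : ∀ P t → maybe (bit ∘ P) 0 (fired t) ≤ bit (touches P t)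
touches-fired P idle       = z≤n
touches-fired P (leaf i)   = ≤-refl
touches-fired P (node l r) = ≤-trans (touches-fired P l) (bit-mono-∨ˡ (touches P l) _)

-- Counts rotors instead of firings: a rotor fires at most one leaf a day, so this bounds the daily
-- cuts, and unlike the firings it is invariant under `turn`.
busy : (ℕ → Bool) → List Rotor → ℕ
busy P []       = 0
busy P (t ∷ ts) = bit (touches P t) + busy P ts

busy-turn : ∀ P ts → busy P (map turn ts) ≡ busy P ts
busy-turn P []       = refl
busy-turn P (t ∷ ts) = cong₂ _+_ (cong bit (touches-turn P t)) (busy-turn P ts)

-- The set cut on one day

member : ∀ {n} → Subset n → ℕ → Bool
member []      _       = false
member (b ∷ p) zero    = b
member (b ∷ p) (suc i) = member p i

∈⇒member : ∀ {n} {e : Fin n} {p} → e ∈ p → member p (toℕ e) ≡ true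
∈⇒member here      = refl
∈⇒member (there m) = ∈⇒member m

member⇒∈ : ∀ {n} {e : Fin n} {p} → member p (toℕ e) ≡ true → e ∈ p
member⇒∈ {e = Fin.zero}  {_ ∷ _} refl = here
member⇒∈ {e = Fin.suc e} {_ ∷ _} eq   = there (member⇒∈ eq)

mark : ∀ {n} → ℕ → Subset n → Subset n
mark i       []      = []
mark zero    (_ ∷ p) = true ∷ p
mark (suc i) (b ∷ p) = b ∷ mark i p

mark-∩ : ∀ {n} i (p q : Subset n) → ∣ mark i p ∩ q ∣ ≤ ∣ p ∩ q ∣ + bit (member q i)
mark-∩ i       []          []          = z≤n
mark-∩ zero    (true ∷ p)  (true ∷ q)  = s≤s (m≤m+n _ _)
mark-∩ zero    (false ∷ p) (true ∷ q)  = ≤-reflexive (+-comm 1 _)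
mark-∩ zero    (true ∷ p)  (false ∷ q) = m≤m+n _ _
mark-∩ zero    (false ∷ p) (false ∷ q) = m≤m+n _ _
mark-∩ (suc i) (true ∷ p)  (true ∷ q)  = s≤s (mark-∩ i p q)
mark-∩ (suc i) (false ∷ p) (true ∷ q)  = mark-∩ i p q
mark-∩ (suc i) (true ∷ p)  (false ∷ q) = mark-∩ i p q
mark-∩ (suc i) (false ∷ p) (false ∷ q) = mark-∩ i p q

∈-mark : ∀ {n} (e : Fin n) p → e ∈ mark (toℕ e) p
∈-mark Fin.zero    (_ ∷ p) = here
∈-mark (Fin.suc e) (_ ∷ p) = there (∈-mark e p)

mark-mono : ∀ {n} {e : Fin n} i {p} → e ∈ p → e ∈ mark i p
mark-mono zero    here      = here
mark-mono zero    (there m) = there m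
mark-mono (suc i) here      = here
mark-mono (suc i) (there m) = there (mark-mono i m)

markFired : ∀ {n} → Maybe ℕ → Subset n → Subset n
markFired = maybe mark id

cut : ∀ {n} → List Rotor → Subset n → Subset n
cut []       p = p
cut (t ∷ ts) p = cut ts (markFired (fired t) p)

cut-mono : ∀ {n} {e : Fin n} ts {p} → e ∈ p → e ∈ cut ts p
cut-mono []       m = m
cut-mono (t ∷ ts) m with fired t
... | nothing = cut-mono ts m
... | just i  = cut-mono ts (mark-mono i m)

∈-cut : ∀ {n} {e : Fin n} {ts} → Any (λ t → fired t ≡ just (toℕ e)) ts → ∀ p → e ∈ cut ts p
∈-cut {e = e} {t ∷ ts} (here eq) p rewrite eq = cut-mono ts (∈-mark e p)
∈-cut (there m) p = ∈-cut m _

cut-∩ : ∀ {n} ts (p q : Subset n) → ∣ cut ts p ∩ q ∣ ≤ ∣ p ∩ q ∣ + busy (member q) ts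
cut-∩ []       p q = m≤m+n _ _
cut-∩ (t ∷ ts) p q = begin
  ∣ cut ts p′ ∩ q ∣                                          ≤⟨ cut-∩ ts p′ q ⟩
  ∣ p′ ∩ q ∣ + busy (member q) ts                            ≤⟨ +-monoˡ-≤ _ (step (fired t) (touches-fired (member q) t)) ⟩
  ∣ p ∩ q ∣ + bit (touches (member q) t) + busy (member q) ts ≡⟨ +-assoc ∣ p ∩ q ∣ _ _ ⟩
  ∣ p ∩ q ∣ + busy (member q) (t ∷ ts)                       ∎
  where
  open ≤-Reasoning
  p′ = markFired (fired t) p
  step : ∀ f {k} → maybe (bit ∘ member q) 0 f ≤ k → ∣ markFired f p ∩ q ∣ ≤ ∣ p ∩ q ∣ + k
  step nothing  _  = m≤m+n _ _
  step (just i) le = ≤-trans (mark-∩ i p q) (+-monoʳ-≤ _ le)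

-- The slot sₖ of [s₁, s₂, …] hangs at depth k, so an idle sₖ leaves a share 2⁻ᵏ of
-- the days free.
spine : List Rotor → Rotor
spine []       = idle
spine (s ∷ ss) = node s (spine ss)

-- Insertion with carries

put : Rotor → List Rotor → Rotor → List Rotor × Rotor
put s    ss idle = (s ∷ ss) , idle
put idle ss c    = (c ∷ ss) , idle
put s    ss c    = (idle ∷ ss) , node s c

-- The recursion descends to place `a`, and `put` propagates the carry on the way back. The second
-- component is what overflows at the root, or `idle`.
insert : ℕ → Rotor → List Rotor → List Rotor × Rotor
insert zero    x ss       = ss , x
insert (suc a) x []       = put idle (proj₁ (insert a x [])) (proj₂ (insert a x []))
insert (suc a) x (s ∷ ss) = put s (proj₁ (insert a x ss)) (proj₂ (insert a x ss))

-- The constructors of the two rotors give seven cases of `put`; this view reduces them to the three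
-- that every invariant of the counter distinguishes.
data Put (s : Rotor) (ss : List Rotor) (c : Rotor) : List Rotor × Rotor → Set where
  none  : c ≡ idle → Put s ss c ((s ∷ ss) , idle)
  free  : s ≡ idle → Put s ss c ((c ∷ ss) , idle)
  carry : s ≢ idle → c ≢ idle → Put s ss c ((idle ∷ ss) , node s c)

put-view : ∀ s ss c → Put s ss c (put s ss c)
put-view s          ss idle       = none refl
put-view idle       ss (leaf _)   = free refl
put-view (leaf _)   ss (leaf _)   = carry (λ ()) (λ ())
put-view (node _ _) ss (leaf _)   = carry (λ ()) (λ ())
put-view idle       ss (node _ _) = free refl
put-view (leaf _)   ss (node _ _) = carry (λ ()) (λ ())
put-view (node _ _) ss (node _ _) = carry (λ ()) (λ ())

insert-view : ∀ s a x ss → let ss′ , c = insert a x ss in Put s ss′ c (put s ss′ c)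
insert-view s a x ss = put-view s _ (proj₂ (insert a x ss))

put-touches : ∀ P {s ss c u} → Put s ss c u →
  touches P (spine (proj₁ u)) ∨ touches P (proj₂ u) ≡ touches P s ∨ (touches P (spine ss) ∨ touches P c)
put-touches P {s} (none refl) = ∨-assoc (touches P s) _ _
put-touches P {c = c} (free refl) = trans (∨-identityʳ _) (∨-comm (touches P c) _)
put-touches P {s} {ss} {c} (carry _ _) = begin
  S ∨ (A ∨ C)   ≡⟨ ∨-assoc S A C ⟨
  (S ∨ A) ∨ C   ≡⟨ cong (_∨ C) (∨-comm S A) ⟩
  (A ∨ S) ∨ C   ≡⟨ ∨-assoc A S C ⟩
  A ∨ (S ∨ C)   ∎
  where
  open ≡-Reasoning
  S = touches P (spine ss)
  A = touches P s
  C = touches P c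

insert-touches : ∀ P a x ss →
  touches P (spine (proj₁ (insert a x ss))) ∨ touches P (proj₂ (insert a x ss))
    ≡ touches P (spine ss) ∨ touches P x
insert-touches P zero x ss = refl
insert-touches P (suc a) x [] =
  trans (put-touches P (insert-view idle a x [])) (insert-touches P a x [])
insert-touches P (suc a) x (s ∷ ss) = begin
  touches P (spine (proj₁ (insert (suc a) x (s ∷ ss)))) ∨ touches P (proj₂ (insert (suc a) x (s ∷ ss)))
    ≡⟨ put-touches P (insert-view s a x ss) ⟩
  touches P s ∨ (touches P (spine (proj₁ (insert a x ss))) ∨ touches P (proj₂ (insert a x ss)))
    ≡⟨ cong (touches P s ∨_) (insert-touches P a x ss) ⟩
  touches P s ∨ (touches P (spine ss) ∨ touches P x)  ≡⟨ ∨-assoc (touches P s) _ _ ⟨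
  touches P (spine (s ∷ ss)) ∨ touches P x            ∎
  where open ≡-Reasoning

put-depth : ∀ {s ss c u D} → Put s ss c u →
  depth s ≤ D → depth (spine ss) ≤ D → depth c ≤ D →
  depth (spine (proj₁ u)) ≤ suc D × depth (proj₂ u) ≤ suc D
put-depth (none refl) s≤ ss≤ c≤ = s≤s (⊔-lub s≤ ss≤) , z≤n
put-depth (free refl) s≤ ss≤ c≤ = s≤s (⊔-lub c≤ ss≤) , z≤n
put-depth (carry _ _) s≤ ss≤ c≤ = s≤s (⊔-lub z≤n ss≤) , s≤s (⊔-lub s≤ c≤)

insert-depth : ∀ a x ss {D} → a + depth x ≤ D → depth (spine ss) ≤ D →
  depth (spine (proj₁ (insert a x ss))) ≤ D × depth (proj₂ (insert a x ss)) ≤ D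
insert-depth zero    x ss x≤ ss≤ = ss≤ , x≤
insert-depth (suc a) x [] (s≤s x≤) _ with insert-depth a x [] x≤ z≤n
... | ss′≤ , c≤ = put-depth (insert-view idle a x []) z≤n ss′≤ c≤
insert-depth (suc a) x (s ∷ ss) (s≤s x≤) (s≤s ss≤)
  with insert-depth a x ss x≤ (m⊔n≤o⇒n≤o (depth s) _ ss≤)
... | ss′≤ , c≤ = put-depth (insert-view s a x ss) (m⊔n≤o⇒m≤o (depth s) _ ss≤) ss′≤ c≤

Occurs : ℕ → ℕ → Rotor → Set
Occurs i d t = ∃[ w ] Waits i t d w

occursˡ : ∀ {i d l r} → Occurs i d l → Occurs i (suc d) (node l r)
occursˡ (_ , p) = _ , left p

occursʳ : ∀ {i d l r} → Occurs i d r → Occurs i (suc d) (node l r)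
occursʳ (_ , p) = _ , right p

module _ {i d : ℕ} where

  put-occurs-slot : ∀ {s ss c u} → Put s ss c u → Occurs i d s →
    Occurs i (suc d) (spine (proj₁ u)) ⊎ Occurs i (suc d) (proj₂ u)
  put-occurs-slot (none _)    o = inj₁ (occursˡ o)
  put-occurs-slot (free refl) (_ , ())
  put-occurs-slot (carry _ _) o = inj₂ (occursˡ o)

  put-occurs-rest : ∀ {s ss c u} → Put s ss c u → Occurs i d (spine ss) ⊎ Occurs i d c →
    Occurs i (suc d) (spine (proj₁ u)) ⊎ Occurs i (suc d) (proj₂ u)
  put-occurs-rest (none refl) (inj₁ o) = inj₁ (occursʳ o)
  put-occurs-rest (free _)    (inj₁ o) = inj₁ (occursʳ o)
  put-occurs-rest (free _)    (inj₂ o) = inj₁ (occursˡ o)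
  put-occurs-rest (carry _ _) (inj₁ o) = inj₁ (occursʳ o)
  put-occurs-rest (carry _ _) (inj₂ o) = inj₂ (occursʳ o)

-- A slot, the spine below it and a carry arriving there all hang one level under the same root,
-- before and after a merge. Hence no leaf changes its depth, and its period survives all later
-- insertions.
insert-keeps : ∀ {i d} a x ss → Occurs i d (spine ss) →
  Occurs i d (spine (proj₁ (insert a x ss))) ⊎ Occurs i d (proj₂ (insert a x ss))
insert-keeps zero    x ss       o             = inj₁ o
insert-keeps (suc a) x []       (_ , ())
insert-keeps (suc a) x (s ∷ ss) (_ , left p)  = put-occurs-slot (insert-view s a x ss) (_ , p)
insert-keeps (suc a) x (s ∷ ss) (_ , right p) =
  put-occurs-rest (insert-view s a x ss) (insert-keeps a x ss (_ , p))

insert-adds : ∀ {i} a ss →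
  Occurs i a (spine (proj₁ (insert a (leaf i) ss))) ⊎ Occurs i a (proj₂ (insert a (leaf i) ss))
insert-adds zero    ss       = inj₂ (_ , root)
insert-adds (suc a) []       = put-occurs-rest (insert-view idle a _ []) (insert-adds a [])
insert-adds (suc a) (s ∷ ss) = put-occurs-rest (insert-view s a _ ss) (insert-adds a ss)

-- Exponents of rates

-- The embedding of the naturals, by recursion so that sums and products are preserved by plain
-- induction.
ι : ℕ → ℚ
ι zero    = 0ℚ
ι (suc k) = 1ℚ ℚ.+ ι k

ι-nonNeg : ∀ k → 0ℚ ℚ.≤ ι k
ι-nonNeg zero    = ℚ.≤-refl
ι-nonNeg (suc k) = ℚ.+-mono-≤ {0ℚ} {1ℚ} {0ℚ} {ι k} (ℚ.nonNegative⁻¹ 1ℚ) (ι-nonNeg k)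

ι-mono : ∀ {j k} → j ≤ k → ι j ℚ.≤ ι k
ι-mono {k = k} z≤n = ι-nonNeg k
ι-mono (s≤s p) = ℚ.+-monoʳ-≤ 1ℚ (ι-mono p)

ι-+ : ∀ j k → ι (j + k) ≡ ι j ℚ.+ ι k
ι-+ zero    k = sym (ℚ.+-identityˡ (ι k))
ι-+ (suc j) k = trans (cong (1ℚ ℚ.+_) (ι-+ j k)) (sym (ℚ.+-assoc 1ℚ (ι j) (ι k)))

ι-* : ∀ j k → ι (j * k) ≡ ι j ℚ.* ι k
ι-* zero    k = sym (ℚ.*-zeroˡ (ι k))
ι-* (suc j) k = begin
  ι (k + j * k)              ≡⟨ ι-+ k (j * k) ⟩
  ι k ℚ.+ ι (j * k)          ≡⟨ cong (ι k ℚ.+_) (ι-* j k) ⟩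
  ι k ℚ.+ ι j ℚ.* ι k        ≡⟨ solve 2 (λ x y → y :+ x :* y := (con 1ℚ :+ x) :* y) refl (ι j) (ι k) ⟩
  (1ℚ ℚ.+ ι j) ℚ.* ι k       ∎
  where open ≡-Reasoning; open +-*-Solver

ι-toℚᵘ : ∀ k → ℚ.toℚᵘ (ι k) ℚᵘ.≃ ℚᵘ.mkℚᵘ (+ k) 0
ι-toℚᵘ zero    = ℚᵘ.*≡* refl
ι-toℚᵘ (suc k) = begin
  ℚ.toℚᵘ (1ℚ ℚ.+ ι k)                    ≈⟨ ℚ.toℚᵘ-homo-+ 1ℚ (ι k) ⟩
  ℚᵘ.1ℚᵘ ℚᵘ.+ ℚ.toℚᵘ (ι k)               ≈⟨ ℚᵘ.+-congʳ ℚᵘ.1ℚᵘ (ι-toℚᵘ k) ⟩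
  ℚᵘ.1ℚᵘ ℚᵘ.+ ℚᵘ.mkℚᵘ (+ k) 0            ≈⟨ ℚᵘ.*≡* (cong (ℤ._* (+ 1)) (cong (ℤ._+_ (+ 1)) (ℤ.*-identityʳ (+ k)))) ⟩
  ℚᵘ.mkℚᵘ (+ suc k) 0                    ∎
  where open ℚᵘ.≃-Reasoning

-- Clears denominators: what the binary search finds about numerator and denominator becomes a
-- statement about `q`.
rate-fraction : ∀ {q} → 0ℚ ℚ.≤ q → q ℚ.* ι (↧ₙ q) ≡ ι ℤ.∣ ↥ q ∣
rate-fraction {q@(mkℚ (+ a) d _)} _ = ℚ.toℚᵘ-injective (begin
  ℚ.toℚᵘ (q ℚ.* ι (suc d))                    ≈⟨ ℚ.toℚᵘ-homo-* q (ι (suc d)) ⟩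
  ℚ.toℚᵘ q ℚᵘ.* ℚ.toℚᵘ (ι (suc d))            ≈⟨ ℚᵘ.*-congˡ {ℚ.toℚᵘ q} (ι-toℚᵘ (suc d)) ⟩
  ℚᵘ.mkℚᵘ (+ a) d ℚᵘ.* ℚᵘ.mkℚᵘ (+ suc d) 0    ≈⟨ ℚᵘ.*≡* eq ⟩
  ℚᵘ.mkℚᵘ (+ a) 0                             ≈⟨ ι-toℚᵘ a ⟨
  ℚ.toℚᵘ (ι a)                                ∎)
  where
  open ℚᵘ.≃-Reasoning
  eq : (+ a ℤ.* + suc d) ℤ.* + 1 ≡ + a ℤ.* (+ suc d ℤ.* + 1)
  eq = ℤ.*-assoc (+ a) (+ suc d) (+ 1)
rate-fraction {mkℚ -[1+ a ] d _} (ℚ.*≤* ())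

½^_ : ℕ → ℚ
½^ zero  = 1ℚ
½^ suc a = ½ ℚ.* ½^ a

½^-nonNeg : ∀ a → 0ℚ ℚ.≤ ½^ a
½^-nonNeg zero    = ℚ.nonNegative⁻¹ 1ℚ
½^-nonNeg (suc a) = subst (ℚ._≤ ½ ℚ.* ½^ a) (ℚ.*-zeroʳ ½) (ℚ.*-monoˡ-≤-nonNeg ½ (½^-nonNeg a))

½^-inverse : ∀ a → ½^ a ℚ.* ι (2 ^ a) ≡ 1ℚ
½^-inverse zero    = refl
½^-inverse (suc a) = begin
  ½ ℚ.* ½^ a ℚ.* ι (2 * 2 ^ a)              ≡⟨ cong (½ ℚ.* ½^ a ℚ.*_) (ι-* 2 (2 ^ a)) ⟩
  ½ ℚ.* ½^ a ℚ.* (ι 2 ℚ.* ι (2 ^ a))        ≡⟨ solve 2 (λ x y → con ½ :* x :* (con (ι 2) :* y) := x :* y) refl (½^ a) (ι (2 ^ a)) ⟩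
  ½^ a ℚ.* ι (2 ^ a)                        ≡⟨ ½^-inverse a ⟩
  1ℚ                                        ∎
  where open ≡-Reasoning; open +-*-Solver

-- less b x y decides x < y or, when b is true, x ≤ y.
less : Bool → ℕᵇ → ℕᵇ → Bool
less b ℕᵇ.zero  ℕᵇ.zero  = b
less b ℕᵇ.zero  2[1+ y ] = true
less b ℕᵇ.zero  1+[2 y ] = true
less b 2[1+ x ] ℕᵇ.zero  = false
less b 1+[2 x ] ℕᵇ.zero  = false
less b 2[1+ x ] 2[1+ y ] = less b x y
less b 2[1+ x ] 1+[2 y ] = less false x y
less b 1+[2 x ] 2[1+ y ] = less true x y
less b 1+[2 x ] 1+[2 y ] = less b x y

Less : Bool → ℕᵇ → ℕᵇ → Set
Less false x y = x ℕᵇ.< y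
Less true  x y = x ℕᵇ.≤ y

less-sound : ∀ b x y → less b x y ≡ true → Less b x y
less-sound true  ℕᵇ.zero  ℕᵇ.zero  _  = inj₂ refl
less-sound false ℕᵇ.zero  2[1+ y ] _  = ℕᵇ.0<even
less-sound true  ℕᵇ.zero  2[1+ y ] _  = inj₁ ℕᵇ.0<even
less-sound false ℕᵇ.zero  1+[2 y ] _  = ℕᵇ.0<odd
less-sound true  ℕᵇ.zero  1+[2 y ] _  = inj₁ ℕᵇ.0<odd
less-sound false 2[1+ x ] 2[1+ y ] eq = ℕᵇ.even<even (less-sound false x y eq)
less-sound true  2[1+ x ] 2[1+ y ] eq with less-sound true x y eq
... | inj₁ lt   = inj₁ (ℕᵇ.even<even lt)
... | inj₂ refl = inj₂ refl
less-sound false 2[1+ x ] 1+[2 y ] eq = ℕᵇ.even<odd (less-sound false x y eq)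
less-sound true  2[1+ x ] 1+[2 y ] eq = inj₁ (ℕᵇ.even<odd (less-sound false x y eq))
less-sound false 1+[2 x ] 2[1+ y ] eq = ℕᵇ.odd<even (less-sound true x y eq)
less-sound true  1+[2 x ] 2[1+ y ] eq = inj₁ (ℕᵇ.odd<even (less-sound true x y eq))
less-sound false 1+[2 x ] 1+[2 y ] eq = ℕᵇ.odd<odd (less-sound false x y eq)
less-sound true  1+[2 x ] 1+[2 y ] eq with less-sound true x y eq
... | inj₁ lt   = inj₁ (ℕᵇ.odd<odd lt)
... | inj₂ refl = inj₂ refl

less-complete : ∀ b x y → Less b x y → less b x y ≡ true
less-complete false _ _ ℕᵇ.0<even        = refl
less-complete false _ _ ℕᵇ.0<odd         = refl
less-complete false _ _ (ℕᵇ.even<even p) = less-complete false _ _ p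
less-complete false _ _ (ℕᵇ.even<odd p)  = less-complete false _ _ p
less-complete false _ _ (ℕᵇ.odd<even p)  = less-complete true _ _ p
less-complete false _ _ (ℕᵇ.odd<odd p)   = less-complete false _ _ p
less-complete true ℕᵇ.zero  _ (inj₁ ℕᵇ.0<even) = refl
less-complete true ℕᵇ.zero  _ (inj₁ ℕᵇ.0<odd)  = refl
less-complete true 2[1+ x ] _ (inj₁ (ℕᵇ.even<even p)) = less-complete true x _ (inj₁ p)
less-complete true 2[1+ x ] _ (inj₁ (ℕᵇ.even<odd p))  = less-complete false x _ p
less-complete true 1+[2 x ] _ (inj₁ (ℕᵇ.odd<even p))  = less-complete true x _ p
less-complete true 1+[2 x ] _ (inj₁ (ℕᵇ.odd<odd p))   = less-complete true x _ (inj₁ p)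
less-complete true ℕᵇ.zero  _ (inj₂ refl) = refl
less-complete true 2[1+ x ] _ (inj₂ refl) = less-complete true x x (inj₂ refl)
less-complete true 1+[2 x ] _ (inj₂ refl) = less-complete true x x (inj₂ refl)

less-false : ∀ x y → less true x y ≡ false → y ℕᵇ.< x
less-false x y eq with ℕᵇ.<-cmp x y
... | tri< lt _ _ with () ← trans (sym eq) (less-complete true x y (inj₁ lt))
... | tri≈ _ e _  with () ← trans (sym eq) (less-complete true x y (inj₂ e))
... | tri> _ _ gt = gt

-- The exponent search doubles `x` only while it is below `y`; this bounds the cost of each doubling
-- by the length of `y`.
size-mono-< : ∀ {x y} → x ℕᵇ.< y → ℕᵇ.size x ≤ ℕᵇ.size y
size-mono-< ℕᵇ.0<even                   = z≤n
size-mono-< ℕᵇ.0<odd                    = z≤n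
size-mono-< (ℕᵇ.even<even p)            = s≤s (size-mono-< p)
size-mono-< (ℕᵇ.even<odd p)             = s≤s (size-mono-< p)
size-mono-< (ℕᵇ.odd<even (inj₁ p))      = s≤s (size-mono-< p)
size-mono-< (ℕᵇ.odd<even (inj₂ refl))   = ≤-refl
size-mono-< (ℕᵇ.odd<odd p)              = s≤s (size-mono-< p)

-- In bijective base 2 the largest number with k digits is 2^(k+1) - 2, all digits being 2. The
-- sharp constant makes the induction close.
toℕ-size : ∀ x → 2 + ℕᵇ.toℕ x ≤ 2 ^ suc (ℕᵇ.size x)
toℕ-size ℕᵇ.zero  = ≤-refl
toℕ-size 2[1+ x ] = ≤-trans (≤-reflexive (sym (*-distribˡ-+ 2 1 (suc (ℕᵇ.toℕ x))))) (*-monoʳ-≤ 2 (toℕ-size x))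
toℕ-size 1+[2 x ] = ≤-trans (≤-trans (n≤1+n _) (≤-reflexive (sym (*-distribˡ-+ 2 2 (ℕᵇ.toℕ x))))) (*-monoʳ-≤ 2 (toℕ-size x))

-- The least a with y ≤ 2ᵃ x if that is at most the fuel, and the fuel otherwise.
exponent : ℕ → ℕᵇ → ℕᵇ → ℕ
exponent zero       x y = 0
exponent (suc fuel) x y with less true y x
... | true  = 0
... | false = suc (exponent fuel (ℕᵇ.double x) y)

shift-double : ∀ a x → 2 ^ a * ℕᵇ.toℕ (ℕᵇ.double x) ≡ 2 ^ suc a * ℕᵇ.toℕ x
shift-double a x = begin
  2 ^ a * ℕᵇ.toℕ (ℕᵇ.double x)   ≡⟨ cong (2 ^ a *_) (ℕᵇ.toℕ-double x) ⟩
  2 ^ a * (2 * ℕᵇ.toℕ x)         ≡⟨ *-assoc (2 ^ a) 2 _ ⟨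
  2 ^ a * 2 * ℕᵇ.toℕ x           ≡⟨ cong (_* ℕᵇ.toℕ x) (*-comm (2 ^ a) 2) ⟩
  2 ^ suc a * ℕᵇ.toℕ x           ∎
  where open ≡-Reasoning

exponent-lower : ∀ fuel x y → ℕᵇ.toℕ y ≤ 2 ^ fuel * ℕᵇ.toℕ x →
  ℕᵇ.toℕ y ≤ 2 ^ exponent fuel x y * ℕᵇ.toℕ x
exponent-lower zero       x y p = p
exponent-lower (suc fuel) x y p with less true y x in eq
... | true  = ≤-trans (ℕᵇ.toℕ-mono-≤ (less-sound true y x eq)) (≤-reflexive (sym (+-identityʳ _)))
... | false = subst (ℕᵇ.toℕ y ≤_) (shift-double (exponent fuel _ y) x)
                (exponent-lower fuel _ y (subst (ℕᵇ.toℕ y ≤_) (sym (shift-double fuel x)) p))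

-- The hypothesis is the loop invariant: a doubling happens only if x < y and so leaves 2x ≤ 2y. It
-- also covers a search that stops at once.
exponent-upper : ∀ fuel x y → ℕᵇ.toℕ x ≤ 2 * ℕᵇ.toℕ y →
  2 ^ exponent fuel x y * ℕᵇ.toℕ x ≤ 2 * ℕᵇ.toℕ y
exponent-upper zero       x y p = ≤-trans (≤-reflexive (+-identityʳ _)) p
exponent-upper (suc fuel) x y p with less true y x in eq
... | true  = ≤-trans (≤-reflexive (+-identityʳ _)) p
... | false = subst (_≤ 2 * ℕᵇ.toℕ y) (shift-double (exponent fuel _ y) x)
                (exponent-upper fuel _ y
                  (subst (_≤ 2 * ℕᵇ.toℕ y) (sym (ℕᵇ.toℕ-double x))
                    (*-monoʳ-≤ 2 (<⇒≤ (ℕᵇ.toℕ-mono-< (less-false y x eq))))))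

exponent-fuel : ∀ fuel x y → exponent fuel x y ≤ fuel
exponent-fuel zero       x y = z≤n
exponent-fuel (suc fuel) x y with less true y x
... | true  = z≤n
... | false = s≤s (exponent-fuel fuel _ y)

fuel-enough : ∀ x y → 0 < ℕᵇ.toℕ x → ℕᵇ.toℕ y ≤ 2 ^ suc (ℕᵇ.size y) * ℕᵇ.toℕ x
fuel-enough x y 0<x = begin
  ℕᵇ.toℕ y                            ≤⟨ m≤n+m _ 2 ⟩
  2 + ℕᵇ.toℕ y                        ≤⟨ toℕ-size y ⟩
  2 ^ suc (ℕᵇ.size y)                 ≡⟨ *-identityʳ _ ⟨
  2 ^ suc (ℕᵇ.size y) * 1             ≤⟨ *-monoʳ-≤ (2 ^ suc (ℕᵇ.size y)) 0<x ⟩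
  2 ^ suc (ℕᵇ.size y) * ℕᵇ.toℕ x      ∎
  where open ≤-Reasoning

ratioLevel : ℕᵇ → ℕᵇ → Maybe ℕ
ratioLevel ℕᵇ.zero y = nothing
ratioLevel x       y = just (exponent (suc (ℕᵇ.size y)) x y)

numerator denominator : ℚ → ℕᵇ
numerator q   = ℕᵇ.fromℕ ℤ.∣ ↥ q ∣
denominator q = ℕᵇ.fromℕ (↧ₙ q)

level : ℚ → Maybe ℕ
level q = ratioLevel (numerator q) (denominator q)

ratioLevel-nothing : ∀ x y → ratioLevel x y ≡ nothing → x ≡ ℕᵇ.zero
ratioLevel-nothing ℕᵇ.zero y _ = refl

ratioLevel-lower : ∀ x y {a} → ratioLevel x y ≡ just a → ℕᵇ.toℕ y ≤ 2 ^ a * ℕᵇ.toℕ x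
ratioLevel-lower x@(2[1+ _ ]) y refl = exponent-lower (suc (ℕᵇ.size y)) x y (fuel-enough x y (s≤s z≤n))
ratioLevel-lower x@(1+[2 _ ]) y refl = exponent-lower (suc (ℕᵇ.size y)) x y (fuel-enough x y (s≤s z≤n))

ratioLevel-upper : ∀ x y {a} → ratioLevel x y ≡ just a → ℕᵇ.toℕ x ≤ 2 * ℕᵇ.toℕ y →
  2 ^ a * ℕᵇ.toℕ x ≤ 2 * ℕᵇ.toℕ y
ratioLevel-upper x@(2[1+ _ ]) y refl = exponent-upper (suc (ℕᵇ.size y)) x y
ratioLevel-upper x@(1+[2 _ ]) y refl = exponent-upper (suc (ℕᵇ.size y)) x y

ratioLevel-size : ∀ x y {a} → ratioLevel x y ≡ just a → a ≤ suc (ℕᵇ.size y)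
ratioLevel-size x@(2[1+ _ ]) y refl = exponent-fuel (suc (ℕᵇ.size y)) x y
ratioLevel-size x@(1+[2 _ ]) y refl = exponent-fuel (suc (ℕᵇ.size y)) x y

ι-positive : ∀ k → ℚ.Positive (ι (suc k))
ι-positive k = ℚ.positive (ℚ.<-≤-trans {0ℚ} {1ℚ} (ℚ.positive⁻¹ 1ℚ) (ℚ.+-monoʳ-≤ 1ℚ (ι-nonNeg k)))

module _ {q : ℚ} (0≤q : 0ℚ ℚ.≤ q) where

  private
    a = ℤ.∣ ↥ q ∣
    d = ↧ₙ q

  level-nothing : level q ≡ nothing → q ≡ 0ℚ
  level-nothing eq = ℚ.≃⇒≡ {q} {0ℚ} (ℚ.*≡* (trans (ℤ.*-identityʳ (↥ q)) (ℤ.∣i∣≡0⇒i≡0 a≡0)))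
    where
    a≡0 : a ≡ 0
    a≡0 = trans (sym (ℕᵇ.toℕ-fromℕ a)) (cong ℕᵇ.toℕ (ratioLevel-nothing (numerator q) (denominator q) eq))

  module _ {x : ℕ} (eq : level q ≡ just x) where

    level-lower : ½^ x ℚ.≤ q
    level-lower = subst₂ ℚ._≤_ (ℚ.*-identityʳ _) absorb (ℚ.*-monoˡ-≤-nonNeg (½^ x) {{ℚ.nonNegative (½^-nonNeg x)}} 1≤)
      where
      d≤ : d ≤ 2 ^ x * a
      d≤ = subst₂ (λ u v → u ≤ 2 ^ x * v) (ℕᵇ.toℕ-fromℕ d) (ℕᵇ.toℕ-fromℕ a)
             (ratioLevel-lower (numerator q) (denominator q) eq)
      1≤ : 1ℚ ℚ.≤ ι (2 ^ x) ℚ.* q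
      1≤ = ℚ.*-cancelʳ-≤-pos (ι d) {{ι-positive (ℚ.denominator-1 q)}} (begin
        1ℚ ℚ.* ι d                      ≡⟨ ℚ.*-identityˡ (ι d) ⟩
        ι d                             ≤⟨ ι-mono d≤ ⟩
        ι (2 ^ x * a)                   ≡⟨ ι-* (2 ^ x) a ⟩
        ι (2 ^ x) ℚ.* ι a               ≡⟨ cong (ι (2 ^ x) ℚ.*_) (rate-fraction 0≤q) ⟨
        ι (2 ^ x) ℚ.* (q ℚ.* ι d)       ≡⟨ ℚ.*-assoc (ι (2 ^ x)) q (ι d) ⟨
        ι (2 ^ x) ℚ.* q ℚ.* ι d         ∎)
        where open ℚ.≤-Reasoning
      absorb : ½^ x ℚ.* (ι (2 ^ x) ℚ.* q) ≡ q
      absorb = trans (sym (ℚ.*-assoc (½^ x) (ι (2 ^ x)) q))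
                 (trans (cong (ℚ._* q) (½^-inverse x)) (ℚ.*-identityˡ q))

    level-upper : q ℚ.≤ 1ℚ → ι (2 ^ x) ℚ.* q ℚ.≤ ι 2
    level-upper q≤1 = ℚ.*-cancelʳ-≤-pos (ι d) {{ι-positive (ℚ.denominator-1 q)}} (begin
      ι (2 ^ x) ℚ.* q ℚ.* ι d           ≡⟨ ℚ.*-assoc (ι (2 ^ x)) q (ι d) ⟩
      ι (2 ^ x) ℚ.* (q ℚ.* ι d)         ≡⟨ cong (ι (2 ^ x) ℚ.*_) (rate-fraction 0≤q) ⟩
      ι (2 ^ x) ℚ.* ι a                 ≡⟨ ι-* (2 ^ x) a ⟨
      ι (2 ^ x * a)                     ≤⟨ ι-mono ≤d ⟩
      ι (2 * d)                         ≡⟨ ι-* 2 d ⟩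
      ι 2 ℚ.* ι d                       ∎)
      where
      open ℚ.≤-Reasoning
      ↥q≤d : ↥ q ℤ.≤ + d
      ↥q≤d = subst₂ ℤ._≤_ (ℤ.*-identityʳ (↥ q)) (ℤ.*-identityˡ (+ d)) (ℚ.drop-*≤* q≤1)
      +a≡ : ∀ {z} → 0ℚ ℚ.≤ z → + ℤ.∣ ↥ z ∣ ≡ ↥ z
      +a≡ {mkℚ (+ _) _ _}    _ = refl
      +a≡ {mkℚ -[1+ _ ] _ _} (ℚ.*≤* ())
      a≤d : a ≤ d
      a≤d = ℤ.drop‿+≤+ (subst (ℤ._≤ + d) (sym (+a≡ 0≤q)) ↥q≤d)
      ≤d : 2 ^ x * a ≤ 2 * d
      ≤d = subst₂ (λ u v → 2 ^ x * u ≤ 2 * v) (ℕᵇ.toℕ-fromℕ a) (ℕᵇ.toℕ-fromℕ d)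
             (ratioLevel-upper (numerator q) (denominator q) eq
               (subst₂ (λ u v → u ≤ 2 * v) (sym (ℕᵇ.toℕ-fromℕ a)) (sym (ℕᵇ.toℕ-fromℕ d))
                 (≤-trans a≤d (m≤m+n d (d + 0)))))

weight : Maybe ℕ → ℚ
weight = maybe ½^_ 0ℚ

weight-nonNeg : ∀ l → 0ℚ ℚ.≤ weight l
weight-nonNeg nothing  = ℚ.≤-refl
weight-nonNeg (just a) = ½^-nonNeg a

weight-level : ∀ {q} → 0ℚ ℚ.≤ q → weight (level q) ℚ.≤ q
weight-level {q} 0≤q with level q in eq
... | nothing = 0≤q
... | just a  = level-lower 0≤q eq

-- Packing a block

-- The share of the days on which the rotor fires a leaf.
load : Rotor → ℚ
load idle       = 0ℚ
load (leaf _)   = 1ℚ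
load (node l r) = ½ ℚ.* (load l ℚ.+ load r)

0≤½* : ∀ {p} → 0ℚ ℚ.≤ p → 0ℚ ℚ.≤ ½ ℚ.* p
0≤½* {p} 0≤p = subst (ℚ._≤ ½ ℚ.* p) (ℚ.*-zeroʳ ½) (ℚ.*-monoˡ-≤-nonNeg ½ 0≤p)

0<½* : ∀ {p} → 0ℚ ℚ.< p → 0ℚ ℚ.< ½ ℚ.* p
0<½* {p} 0<p = subst (ℚ._< ½ ℚ.* p) (ℚ.*-zeroʳ ½) (ℚ.*-monoʳ-<-pos ½ 0<p)

load-nonNeg : ∀ t → 0ℚ ℚ.≤ load t
load-nonNeg idle       = ℚ.≤-refl
load-nonNeg (leaf _)   = ℚ.nonNegative⁻¹ 1ℚ
load-nonNeg (node l r) = 0≤½* (ℚ.+-mono-≤ {0ℚ} {load l} {0ℚ} {load r} (load-nonNeg l) (load-nonNeg r))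

touches⇒load-pos : ∀ P t → touches P t ≡ true → 0ℚ ℚ.< load t
touches⇒load-pos P (leaf _) _ = ℚ.positive⁻¹ 1ℚ
touches⇒load-pos P (node l r) eq with touches P l in eqˡ
... | true  = 0<½* (ℚ.+-mono-<-≤ {0ℚ} {load l} {0ℚ} {load r} (touches⇒load-pos P l eqˡ) (load-nonNeg r))
... | false = 0<½* (ℚ.+-mono-≤-< {0ℚ} {load l} {0ℚ} {load r} (load-nonNeg l) (touches⇒load-pos P r eq))

Tight : Rotor → Set
Tight t = t ≡ idle ⊎ load t ≡ 1ℚ

put-load : ∀ {s ss c u} → Put s ss c u →
  load (spine (proj₁ u)) ℚ.+ load (proj₂ u) ≡ ½ ℚ.* (load s ℚ.+ (load (spine ss) ℚ.+ load c))
put-load {s} {ss} (none refl) =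
  solve 2 (λ x y → con ½ :* (x :+ y) :+ con 0ℚ := con ½ :* (x :+ (y :+ con 0ℚ))) refl (load s) (load (spine ss))
  where open +-*-Solver
put-load {ss = ss} {c} (free refl) =
  solve 2 (λ y z → con ½ :* (z :+ y) :+ con 0ℚ := con ½ :* (con 0ℚ :+ (y :+ z))) refl (load (spine ss)) (load c)
  where open +-*-Solver
put-load {s} {ss} {c} (carry _ _) =
  solve 3 (λ x y z → con ½ :* (con 0ℚ :+ y) :+ con ½ :* (x :+ z) := con ½ :* (x :+ (y :+ z))) refl
    (load s) (load (spine ss)) (load c)
  where open +-*-Solver

-- Load is conserved: a slot or carry counts one half both inside the spine and inside a merged
-- carry.
insert-load : ∀ a x ss → let ss′ , c = insert a x ss in
  load (spine ss′) ℚ.+ load c ≡ load (spine ss) ℚ.+ ½^ a ℚ.* load x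
insert-load zero x ss = cong (load (spine ss) ℚ.+_) (sym (ℚ.*-identityˡ (load x)))
insert-load (suc a) x [] = begin
  _                                                    ≡⟨ put-load (insert-view idle a x []) ⟩
  ½ ℚ.* (0ℚ ℚ.+ (load (spine ss′) ℚ.+ load c))         ≡⟨ cong (λ l → ½ ℚ.* (0ℚ ℚ.+ l)) (insert-load a x []) ⟩
  ½ ℚ.* (0ℚ ℚ.+ (0ℚ ℚ.+ ½^ a ℚ.* load x))              ≡⟨ solve 2 (λ y z → con ½ :* (con 0ℚ :+ (con 0ℚ :+ y :* z)) := con 0ℚ :+ con ½ :* y :* z) refl (½^ a) (load x) ⟩
  0ℚ ℚ.+ ½ ℚ.* ½^ a ℚ.* load x                         ∎
  where
  open ≡-Reasoning
  open +-*-Solver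
  ss′ = proj₁ (insert a x [])
  c   = proj₂ (insert a x [])
insert-load (suc a) x (s ∷ ss) = begin
  _                                                                ≡⟨ put-load (insert-view s a x ss) ⟩
  ½ ℚ.* (load s ℚ.+ (load (spine ss′) ℚ.+ load c))                 ≡⟨ cong (λ l → ½ ℚ.* (load s ℚ.+ l)) (insert-load a x ss) ⟩
  ½ ℚ.* (load s ℚ.+ (load (spine ss) ℚ.+ ½^ a ℚ.* load x))         ≡⟨ solve 4 (λ p q y z → con ½ :* (p :+ (q :+ y :* z)) := con ½ :* (p :+ q) :+ con ½ :* y :* z) refl (load s) (load (spine ss)) (½^ a) (load x) ⟩
  load (spine (s ∷ ss)) ℚ.+ ½ ℚ.* ½^ a ℚ.* load x                  ∎
  where
  open ≡-Reasoning
  open +-*-Solver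
  ss′ = proj₁ (insert a x ss)
  c   = proj₂ (insert a x ss)

-- A merge averages two loads equal to 1. Tightness is claimed of the slots and the carry, not of
-- the spine, whose load may be fractional.
put-tight : ∀ {s ss c u} → Put s ss c u → Tight s → All Tight ss → Tight c →
  All Tight (proj₁ u) × Tight (proj₂ u)
put-tight (none _)        s ss c = (s ∷ ss) , inj₁ refl
put-tight (free _)        s ss c = (c ∷ ss) , inj₁ refl
put-tight (carry s≢ c≢) (inj₁ s≡) ss c = ⊥-elim (s≢ s≡)
put-tight (carry s≢ c≢) (inj₂ _) ss (inj₁ c≡) = ⊥-elim (c≢ c≡)
put-tight (carry _ _) (inj₂ s) ss (inj₂ c) = (inj₁ refl ∷ ss) , inj₂ (cong (½ ℚ.*_) (cong₂ ℚ._+_ s c))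

insert-tight : ∀ a x ss → Tight x → All Tight ss → let ss′ , c = insert a x ss in All Tight ss′ × Tight c
insert-tight zero    x ss       tx tss = tss , tx
insert-tight (suc a) x []       tx _ with insert-tight a x [] tx []
... | tss′ , tc = put-tight (insert-view idle a x []) (inj₁ refl) tss′ tc
insert-tight (suc a) x (s ∷ ss) tx (ts ∷ tss) with insert-tight a x ss tx tss
... | tss′ , tc = put-tight (insert-view s a x ss) ts tss′ tc

-- Sums over a subset

sumOver : ∀ {n} → Subset n → (Fin n → ℚ) → ℚ
sumOver []          f = 0ℚ
sumOver (false ∷ p) f = sumOver p (f ∘ Fin.suc)
sumOver (true ∷ p)  f = f Fin.zero ℚ.+ sumOver p (f ∘ Fin.suc)

sumOver-mono : ∀ {n} (p : Subset n) {f g} → (∀ e → f e ℚ.≤ g e) → sumOver p f ℚ.≤ sumOver p g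
sumOver-mono []          f≤g = ℚ.≤-refl
sumOver-mono (false ∷ p) f≤g = sumOver-mono p (f≤g ∘ Fin.suc)
sumOver-mono (true ∷ p)  f≤g = ℚ.+-mono-≤ (f≤g Fin.zero) (sumOver-mono p (f≤g ∘ Fin.suc))

sumOver-cong : ∀ {n} (p : Subset n) {f g} → (∀ e → f e ≡ g e) → sumOver p f ≡ sumOver p g
sumOver-cong []          eq = refl
sumOver-cong (false ∷ p) eq = sumOver-cong p (eq ∘ Fin.suc)
sumOver-cong (true ∷ p)  eq = cong₂ ℚ._+_ (eq Fin.zero) (sumOver-cong p (eq ∘ Fin.suc))

sumOver-zero : ∀ {n} (p : Subset n) → sumOver p (λ _ → 0ℚ) ≡ 0ℚ
sumOver-zero []          = refl
sumOver-zero (false ∷ p) = sumOver-zero p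
sumOver-zero (true ∷ p)  = trans (ℚ.+-identityˡ _) (sumOver-zero p)

sumOver-nonNeg : ∀ {n} (p : Subset n) {f} → (∀ e → 0ℚ ℚ.≤ f e) → 0ℚ ℚ.≤ sumOver p f
sumOver-nonNeg p {f} 0≤f = subst (ℚ._≤ sumOver p f) (sumOver-zero p) (sumOver-mono p 0≤f)

-- The overflow is stored even when it is `idle`: such a rotor cuts nothing, and at most one is
-- added per bamboo.
plant : Maybe ℕ → ℕ → List Rotor → List Rotor → List Rotor × List Rotor
plant nothing  i ss ts = ss , ts
plant (just a) i ss ts = proj₁ (insert a (leaf i) ss) , proj₂ (insert a (leaf i) ss) ∷ ts

pack : ∀ {n} → ℕ → Subset n → (Fin n → Maybe ℕ) → List Rotor → List Rotor → List Rotor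
pack i []          lv ss ts = spine ss ∷ ts
pack i (false ∷ p) lv ss ts = pack (suc i) p (lv ∘ Fin.suc) ss ts
pack i (true ∷ p)  lv ss ts =
  pack (suc i) p (lv ∘ Fin.suc) (proj₁ (plant (lv Fin.zero) i ss ts)) (proj₂ (plant (lv Fin.zero) i ss ts))

0≤+ : ∀ {p q} → 0ℚ ℚ.≤ p → 0ℚ ℚ.≤ q → 0ℚ ℚ.≤ p ℚ.+ q
0≤+ {p} {q} = ℚ.+-mono-≤ {0ℚ} {p} {0ℚ} {q}

-- Here the integrality of capacities enters: a positive load, however small, rules out k = 0 and so
-- leaves room for a whole rotor.
touches≤ : ∀ P t {k} → load t ℚ.≤ ι k → bit (touches P t) ≤ k
touches≤ P t le with touches P t in eq
touches≤ P t _ | false = z≤n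
touches≤ P t {suc k} _ | true = s≤s z≤n
touches≤ P t {zero} le | true = ⊥-elim (ℚ.<-irrefl refl (ℚ.<-≤-trans (touches⇒load-pos P t eq) le))

bit≤1 : ∀ b → bit b ≤ 1
bit≤1 false = z≤n
bit≤1 true  = ≤-refl

carry-capacity : ∀ P c {r k} → Tight c → 0ℚ ℚ.≤ r → load c ℚ.+ r ℚ.≤ ι k →
  ∃[ k′ ] (r ℚ.≤ ι k′ × k′ + bit (touches P c) ≤ k)
carry-capacity P c {r} {k} (inj₁ refl) _ le = k , subst (ℚ._≤ ι k) (ℚ.+-identityˡ r) le , ≤-reflexive (+-identityʳ k)
carry-capacity P c {r} {zero} (inj₂ eq) 0≤r le =
  ⊥-elim (ℚ.<-irrefl refl (ℚ.<-≤-trans (ℚ.+-mono-<-≤ {0ℚ} {load c} {0ℚ} {r} (subst (0ℚ ℚ.<_) (sym eq) (ℚ.positive⁻¹ 1ℚ)) 0≤r) le))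
carry-capacity P c {r} {suc k} (inj₂ eq) _ le =
  k , subst₂ ℚ._≤_ (cancel r) (cancel (ι k)) (ℚ.+-monoʳ-≤ (ℚ.- 1ℚ) (subst (λ l → l ℚ.+ r ℚ.≤ ι (suc k)) eq le))
    , ≤-trans (+-monoʳ-≤ k (bit≤1 (touches P c))) (≤-reflexive (+-comm k 1))
  where
  open +-*-Solver
  cancel : ∀ x → ℚ.- 1ℚ ℚ.+ (1ℚ ℚ.+ x) ≡ x
  cancel x = solve 1 (λ x → con (ℚ.- 1ℚ) :+ (con 1ℚ :+ x) := x) refl x

-- `k` is the capacity left over by the rotors already emitted. It must cover the counter and the
-- bamboos still to come; each full overflow takes one unit of load and one unit of capacity.
pack-busy : ∀ {n} P i (p : Subset n) lv ss ts {k} → All Tight ss →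
  load (spine ss) ℚ.+ sumOver p (weight ∘ lv) ℚ.≤ ι k → busy P (pack i p lv ss ts) ≤ k + busy P ts
pack-busy P i [] lv ss ts {k} _ le =
  +-monoˡ-≤ (busy P ts) (touches≤ P (spine ss) (subst (ℚ._≤ ι k) (ℚ.+-identityʳ (load (spine ss))) le))
pack-busy P i (false ∷ p) lv ss ts tss le = pack-busy P (suc i) p (lv ∘ Fin.suc) ss ts tss le
pack-busy P i (true ∷ p) lv ss ts {k} tss le with lv Fin.zero
... | nothing = pack-busy P (suc i) p (lv ∘ Fin.suc) ss ts tss
                  (subst (λ s → load (spine ss) ℚ.+ s ℚ.≤ ι k) (ℚ.+-identityˡ (sumOver p (weight ∘ lv ∘ Fin.suc))) le)
... | just a = begin
  busy P (pack (suc i) p (lv ∘ Fin.suc) ss′ (c ∷ ts))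
    ≤⟨ pack-busy P (suc i) p (lv ∘ Fin.suc) ss′ (c ∷ ts) {k′} (proj₁ tight) (proj₁ (proj₂ cap)) ⟩
  k′ + (bit (touches P c) + busy P ts)                  ≡⟨ +-assoc k′ _ _ ⟨
  k′ + bit (touches P c) + busy P ts                    ≤⟨ +-monoˡ-≤ _ (proj₂ (proj₂ cap)) ⟩
  k + busy P ts                                         ∎
  where
  open ≤-Reasoning
  open +-*-Solver
  ss′ = proj₁ (insert a (leaf i) ss)
  c   = proj₂ (insert a (leaf i) ss)
  rest = sumOver p (weight ∘ lv ∘ Fin.suc)
  tight : All Tight ss′ × Tight c
  tight = insert-tight a (leaf i) ss (inj₂ refl) tss
  eq : load c ℚ.+ (load (spine ss′) ℚ.+ rest) ≡ load (spine ss) ℚ.+ (½^ a ℚ.+ rest)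
  eq = trans (solve 3 (λ x y z → x :+ (y :+ z) := y :+ x :+ z) refl (load c) (load (spine ss′)) rest)
         (trans (cong (ℚ._+ rest) (insert-load a (leaf i) ss))
           (solve 3 (λ x y z → x :+ y :* con 1ℚ :+ z := x :+ (y :+ z)) refl (load (spine ss)) (½^ a) rest))
  cap = carry-capacity P c (proj₂ tight)
          (0≤+ (load-nonNeg (spine ss′)) (sumOver-nonNeg p (weight-nonNeg ∘ lv ∘ Fin.suc)))
          (subst (ℚ._≤ ι k) (sym eq) le)
  k′ = proj₁ cap

∨-false : ∀ a b → a ∨ b ≡ false → a ≡ false × b ≡ false
∨-false false false _ = refl , refl

-- Lets the capacity of one block be checked on the common list, to which the other blocks
-- contribute nothing.
pack-untouched : ∀ {n} P i (p : Subset n) lv ss ts → (∀ {e} → e ∈ p → P (i + toℕ e) ≡ false) →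
  touches P (spine ss) ≡ false → busy P (pack i p lv ss ts) ≡ busy P ts
pack-untouched P i [] lv ss ts _ eq = cong (λ b → bit b + busy P ts) eq
pack-untouched P i (false ∷ p) lv ss ts avoid eq =
  pack-untouched P (suc i) p (lv ∘ Fin.suc) ss ts
    (λ {e} m → trans (cong P (sym (+-suc i (toℕ e)))) (avoid (there m))) eq
pack-untouched P i (true ∷ p) lv ss ts avoid eq with lv Fin.zero
... | nothing = pack-untouched P (suc i) p (lv ∘ Fin.suc) ss ts
    (λ {e} m → trans (cong P (sym (+-suc i (toℕ e)))) (avoid (there m))) eq
... | just a = trans (pack-untouched P (suc i) p (lv ∘ Fin.suc) ss′ (c ∷ ts)
    (λ {e} m → trans (cong P (sym (+-suc i (toℕ e)))) (avoid (there m))) (proj₁ both))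
    (cong (λ b → bit b + busy P ts) (proj₂ both))
  where
  ss′ = proj₁ (insert a (leaf i) ss)
  c   = proj₂ (insert a (leaf i) ss)
  both : touches P (spine ss′) ≡ false × touches P c ≡ false
  both = ∨-false _ _ (trans (insert-touches P a (leaf i) ss)
           (cong₂ _∨_ eq (trans (cong P (sym (+-identityʳ i))) (avoid here))))

pack-keeps : ∀ {n j d} i (p : Subset n) lv ss ts → Occurs j d (spine ss) ⊎ Any (Occurs j d) ts →
  Any (Occurs j d) (pack i p lv ss ts)
pack-keeps i []          lv ss ts (inj₁ o) = here o
pack-keeps i []          lv ss ts (inj₂ o) = there o
pack-keeps i (false ∷ p) lv ss ts o = pack-keeps (suc i) p (lv ∘ Fin.suc) ss ts o
pack-keeps i (true ∷ p)  lv ss ts o with lv Fin.zero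
... | nothing = pack-keeps (suc i) p (lv ∘ Fin.suc) ss ts o
... | just a  = pack-keeps (suc i) p (lv ∘ Fin.suc) _ _ (step o)
  where
  step : _ → _
  step (inj₂ o) = inj₂ (there o)
  step (inj₁ o) with insert-keeps a (leaf i) ss o
  ... | inj₁ o′ = inj₁ o′
  ... | inj₂ o′ = inj₂ (here o′)

pack-adds : ∀ {n a} {e : Fin n} i p lv ss ts → e ∈ p → lv e ≡ just a →
  Any (Occurs (i + toℕ e) a) (pack i p lv ss ts)
pack-adds {a = a} {Fin.suc e} i (false ∷ p) lv ss ts (there m) eq =
  subst (λ j → Any (Occurs j a) (pack (suc i) p (lv ∘ Fin.suc) ss ts)) (sym (+-suc i (toℕ e)))
    (pack-adds (suc i) p (lv ∘ Fin.suc) ss ts m eq)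
pack-adds {a = a} {Fin.suc e} i (true ∷ p) lv ss ts (there m) eq =
  subst (λ j → Any (Occurs j a) (pack i (true ∷ p) lv ss ts)) (sym (+-suc i (toℕ e)))
    (pack-adds (suc i) p (lv ∘ Fin.suc) _ _ m eq)
pack-adds {a = a} {Fin.zero} i (true ∷ p) lv ss ts here eq
  rewrite eq | +-identityʳ i with insert-adds {i} a ss
... | inj₁ o = pack-keeps (suc i) p (lv ∘ Fin.suc) _ _ (inj₁ o)
... | inj₂ o = pack-keeps (suc i) p (lv ∘ Fin.suc) _ _ (inj₂ (here o))

pack-depth : ∀ {n D} i (p : Subset n) lv ss ts → (∀ e {a} → lv e ≡ just a → a ≤ D) →
  depth (spine ss) ≤ D → All (λ t → depth t ≤ D) ts → All (λ t → depth t ≤ D) (pack i p lv ss ts)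
pack-depth i []          lv ss ts lv≤ ss≤ ts≤ = ss≤ ∷ ts≤
pack-depth i (false ∷ p) lv ss ts lv≤ ss≤ ts≤ = pack-depth (suc i) p _ ss ts (lv≤ ∘ Fin.suc) ss≤ ts≤
pack-depth i (true ∷ p)  lv ss ts lv≤ ss≤ ts≤ with lv Fin.zero in eq
... | nothing = pack-depth (suc i) p _ ss ts (lv≤ ∘ Fin.suc) ss≤ ts≤
... | just a with insert-depth a (leaf i) ss (≤-trans (≤-reflexive (+-identityʳ a)) (lv≤ Fin.zero eq)) ss≤
... | ss′≤ , c≤ = pack-depth (suc i) p _ _ _ (lv≤ ∘ Fin.suc) ss′≤ (c≤ ∷ ts≤)

pack-length : ∀ {n} i (p : Subset n) lv ss ts → length (pack i p lv ss ts) ≤ suc n + length ts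
pack-length i [] lv ss ts = ≤-refl
pack-length i (false ∷ p) lv ss ts = m≤n⇒m≤1+n (pack-length (suc i) p (lv ∘ Fin.suc) ss ts)
pack-length {suc n} i (true ∷ p) lv ss ts with lv Fin.zero
... | nothing = m≤n⇒m≤1+n (pack-length (suc i) p (lv ∘ Fin.suc) ss ts)
... | just a  = ≤-trans (pack-length (suc i) p (lv ∘ Fin.suc) _ _) (≤-reflexive (+-suc (suc n) (length ts)))

-- All blocks in one list of rotors

packAll : ∀ {n m} → (Fin m → Subset n) → (Fin n → Maybe ℕ) → List Rotor → List Rotor
packAll {m = zero}  B lv ts = ts
packAll {m = suc m} B lv ts = packAll (B ∘ Fin.suc) lv (pack 0 (B Fin.zero) lv [] ts)

packAll-untouched : ∀ {n m} P (B : Fin m → Subset n) lv ts → (∀ j {e} → e ∈ B j → P (toℕ e) ≡ false) →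
  busy P (packAll B lv ts) ≡ busy P ts
packAll-untouched {m = zero}  P B lv ts avoid = refl
packAll-untouched {m = suc m} P B lv ts avoid =
  trans (packAll-untouched P (B ∘ Fin.suc) lv _ (avoid ∘ Fin.suc))
        (pack-untouched P 0 (B Fin.zero) lv [] ts (avoid Fin.zero) refl)

packAll-busy : ∀ {n m} P (B : Fin m → Subset n) lv ts j {k} →
  (∀ j′ → j′ ≢ j → ∀ {e} → e ∈ B j′ → P (toℕ e) ≡ false) →
  sumOver (B j) (weight ∘ lv) ℚ.≤ ι k → busy P (packAll B lv ts) ≤ k + busy P ts
packAll-busy {m = suc m} P B lv ts Fin.zero {k} avoid le = ≤-trans
  (≤-reflexive (packAll-untouched P (B ∘ Fin.suc) lv _ (λ j′ → avoid (Fin.suc j′) (λ ()))))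
  (pack-busy P 0 (B Fin.zero) lv [] ts [] (subst (ℚ._≤ ι k) (sym (ℚ.+-identityˡ _)) le))
packAll-busy {m = suc m} P B lv ts (Fin.suc j) {k} avoid le = ≤-trans
  (packAll-busy P (B ∘ Fin.suc) lv _ j (λ j′ j′≢j → avoid (Fin.suc j′) (j′≢j ∘ Fin.suc-injective)) le)
  (≤-reflexive (cong (_+_ k) (pack-untouched P 0 (B Fin.zero) lv [] ts (avoid Fin.zero (λ ())) refl)))

packAll-keeps : ∀ {n m i d} (B : Fin m → Subset n) lv ts → Any (Occurs i d) ts → Any (Occurs i d) (packAll B lv ts)
packAll-keeps {m = zero}  B lv ts o = o
packAll-keeps {m = suc m} B lv ts o = packAll-keeps (B ∘ Fin.suc) lv _ (pack-keeps 0 (B Fin.zero) lv [] ts (inj₂ o))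

packAll-adds : ∀ {n m a} {e : Fin n} (B : Fin m → Subset n) lv ts j → e ∈ B j → lv e ≡ just a →
  Any (Occurs (toℕ e) a) (packAll B lv ts)
packAll-adds {m = suc m} B lv ts Fin.zero    e∈ eq = packAll-keeps (B ∘ Fin.suc) lv _ (pack-adds 0 (B Fin.zero) lv [] ts e∈ eq)
packAll-adds {m = suc m} B lv ts (Fin.suc j) e∈ eq = packAll-adds (B ∘ Fin.suc) lv _ j e∈ eq

packAll-depth : ∀ {n m D} (B : Fin m → Subset n) lv ts → (∀ e {a} → lv e ≡ just a → a ≤ D) →
  All (λ t → depth t ≤ D) ts → All (λ t → depth t ≤ D) (packAll B lv ts)
packAll-depth {m = zero}  B lv ts lv≤ ts≤ = ts≤
packAll-depth {m = suc m} B lv ts lv≤ ts≤ =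
  packAll-depth (B ∘ Fin.suc) lv _ lv≤ (pack-depth 0 (B Fin.zero) lv [] ts lv≤ z≤n ts≤)

packAll-length : ∀ {n m} (B : Fin m → Subset n) lv ts → length (packAll B lv ts) ≤ m * suc n + length ts
packAll-length {m = zero}  B lv ts = ≤-refl
packAll-length {n} {suc m} B lv ts = begin
  length (packAll (B ∘ Fin.suc) lv ts′)    ≤⟨ packAll-length (B ∘ Fin.suc) lv ts′ ⟩
  m * suc n + length ts′                   ≤⟨ +-monoʳ-≤ (m * suc n) (pack-length 0 (B Fin.zero) lv [] ts) ⟩
  m * suc n + (suc n + length ts)          ≡⟨ +-assoc (m * suc n) (suc n) (length ts) ⟨
  m * suc n + suc n + length ts            ≡⟨ cong (_+ length ts) (+-comm (m * suc n) (suc n)) ⟩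
  suc m * suc n + length ts                ∎
  where
  open ≤-Reasoning
  ts′ = pack 0 (B Fin.zero) lv [] ts

-- Correctness of the schedule

turns : ℕ → List Rotor → List Rotor
turns zero    ts = ts
turns (suc t) ts = map turn (turns t ts)

busy-turns : ∀ P t ts → busy P (turns t ts) ≡ busy P ts
busy-turns P zero    ts = refl
busy-turns P (suc t) ts = trans (busy-turn P (turns t ts)) (busy-turns P t ts)

schedule : ∀ {n} → List Rotor → Schedule n
schedule ts t = cut (turns t ts) ⊥

ι-*-mono : ∀ {j k q} → 0ℚ ℚ.≤ q → j ≤ k → ι j ℚ.* q ℚ.≤ ι k ℚ.* q
ι-*-mono {q = q} 0≤q j≤k = ℚ.*-monoʳ-≤-nonNeg q {{ℚ.nonNegative 0≤q}} (ι-mono j≤k)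

suc-ι-* : ∀ k q → ι k ℚ.* q ℚ.+ q ≡ ι (suc k) ℚ.* q
suc-ι-* k q = solve 2 (λ x y → x :* y :+ y := (con 1ℚ :+ x) :* y) refl (ι k) q
  where open +-*-Solver

module _ {n : ℕ} (g : Fin n → ℚ) (π : Schedule n) {e : Fin n} where

  height-uncut : g e ≡ 0ℚ → ∀ t → height g π t e ≡ 0ℚ
  height-uncut g≡0 zero = g≡0
  height-uncut g≡0 (suc t) with e ∈? π t
  ... | yes _ = g≡0
  ... | no  _ = cong₂ ℚ._+_ (height-uncut g≡0 t) g≡0

  height-cut : ∀ {t} → e ∈ π t → height g π (suc t) e ≡ g e
  height-cut {t} e∈ with e ∈? π t
  ... | yes _ = refl
  ... | no e∉ = ⊥-elim (e∉ e∈)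

  height-grow : 0ℚ ℚ.≤ g e → ∀ {t s} → height g π t e ℚ.≤ ι s ℚ.* g e → height g π (suc t) e ℚ.≤ ι (suc s) ℚ.* g e
  height-grow 0≤g {t} {s} le with e ∈? π t
  ... | yes _ = subst (ℚ._≤ ι (suc s) ℚ.* g e) (ℚ.*-identityˡ (g e)) (ι-*-mono {1} {suc s} 0≤g (s≤s z≤n))
  ... | no  _ = subst (height g π t e ℚ.+ g e ℚ.≤_) (suc-ι-* s (g e)) (ℚ.+-monoˡ-≤ (g e) le)

module _ {n : ℕ} (g : Fin n → ℚ) (ts : List Rotor) {e : Fin n} (0≤g : 0ℚ ℚ.≤ g e) {d : ℕ} where

  -- The height never exceeds (2ᵈ ∸ w) g when the next cut is w days ahead.
  record Phase (t : ℕ) : Set where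
    constructor phase
    field
      {age wait} : ℕ
      {rotor}    : Rotor
      present    : rotor ∈ᴸ turns t ts
      waits      : Waits (toℕ e) rotor d wait
      period     : age + wait ≡ 2 ^ d
      bounded    : height g (schedule ts) t e ℚ.≤ ι age ℚ.* g e

  phase-start : Any (Occurs (toℕ e) d) ts → Phase 0
  phase-start o with find o
  -- The bamboo starts as if cut 2^d - w days ago; this age is at least 1 since w < 2^d, which
  -- covers the initial height `g e`.
  ... | r , r∈ , w , p = phase {age = 2 ^ d ∸ w} r∈ p (m∸n+n≡m (<⇒≤ (waits-bound p)))
    (subst (ℚ._≤ ι (2 ^ d ∸ w) ℚ.* g e) (ℚ.*-identityˡ (g e)) (ι-*-mono {1} 0≤g (m<n⇒0<n∸m (waits-bound p))))

  phase-next : ∀ {t} → Phase t → Phase (suc t)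
  phase-next {t} (phase {age} r∈ p per bnd) with waits-turn p
  ... | fires eq full q = phase {age = 1} (∈-map⁺ turn r∈) q full
    (ℚ.≤-reflexive (trans (height-cut g (schedule ts) {t = t} (∈-cut (lose r∈ eq) ⊥)) (sym (ℚ.*-identityˡ (g e)))))
  ... | rests q = phase {age = suc age} (∈-map⁺ turn r∈) q (trans (sym (+-suc age _)) per)
    (height-grow g (schedule ts) 0≤g {t} {age} bnd)

  phases : Any (Occurs (toℕ e) d) ts → ∀ t → Phase t
  phases o zero    = phase-start o
  phases o (suc t) = phase-next (phases o t)

  height-bound : Any (Occurs (toℕ e) d) ts → ∀ t → height g (schedule ts) t e ℚ.≤ ι (2 ^ d) ℚ.* g e
  height-bound o t = ℚ.≤-trans (Phase.bounded ph) (ι-*-mono 0≤g (subst (Phase.age ph ≤_) (Phase.period ph) (m≤m+n _ _)))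
    where ph = phases o t

-- Double counting of the rates

sumOver-+ : ∀ {n} (p : Subset n) f g → sumOver p (λ e → f e ℚ.+ g e) ≡ sumOver p f ℚ.+ sumOver p g
sumOver-+ []          f g = refl
sumOver-+ (false ∷ p) f g = sumOver-+ p (f ∘ Fin.suc) (g ∘ Fin.suc)
sumOver-+ (true ∷ p)  f g = trans (cong (f Fin.zero ℚ.+ g Fin.zero ℚ.+_) (sumOver-+ p (f ∘ Fin.suc) (g ∘ Fin.suc)))
  (solve 4 (λ a b c d → a :+ b :+ (c :+ d) := a :+ c :+ (b :+ d)) refl
    (f Fin.zero) (g Fin.zero) (sumOver p (f ∘ Fin.suc)) (sumOver p (g ∘ Fin.suc)))
  where open +-*-Solver

charge : ∀ {n} → Subset n → ℚ → Fin n → ℚ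
charge I x e = if does (e ∈? I) then x else 0ℚ

charge≤ : ∀ {n} (I : Subset n) {x} e → 0ℚ ℚ.≤ x → charge I x e ℚ.≤ x
charge≤ I e 0≤x with does (e ∈? I)
... | true  = ℚ.≤-refl
... | false = 0≤x

sumOver-charge : ∀ {n} (I B : Subset n) x → sumOver B (charge I x) ≡ ι ∣ I ∩ B ∣ ℚ.* x
sumOver-charge []          []          x = sym (ℚ.*-zeroˡ x)
sumOver-charge (true ∷ I)  (true ∷ B)  x = trans (cong (x ℚ.+_) (sumOver-charge I B x))
  (trans (ℚ.+-comm x _) (suc-ι-* ∣ I ∩ B ∣ x))
sumOver-charge (false ∷ I) (true ∷ B)  x = trans (ℚ.+-identityˡ _) (sumOver-charge I B x)
sumOver-charge (true ∷ I)  (false ∷ B) x = sumOver-charge I B x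
sumOver-charge (false ∷ I) (false ∷ B) x = sumOver-charge I B x

module _ {n : ℕ} (c : Subset n → ℚ) where

  covered : List (Subset n) → Fin n → ℚ
  covered Is e = sumℚ (map c (filter (e ∈?_) Is))

  covered-∷ : ∀ I Is e → covered (I ∷ Is) e ≡ charge I (c I) e ℚ.+ covered Is e
  covered-∷ I Is e with does (e ∈? I)
  ... | true  = refl
  ... | false = sym (ℚ.+-identityˡ _)

  covered≤total : ∀ {Is} → All (λ I → 0ℚ ℚ.≤ c I) Is → ∀ e → covered Is e ℚ.≤ sumℚ (map c Is)
  covered≤total [] e = ℚ.≤-refl
  covered≤total {I ∷ Is} (0≤c ∷ 0≤cs) e = subst (ℚ._≤ sumℚ (map c (I ∷ Is))) (sym (covered-∷ I Is e))
    (ℚ.+-mono-≤ (charge≤ I e 0≤c) (covered≤total 0≤cs e))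

  -- Exchanging the two sums, each set I pays its coefficient once for every element of I ∩ B, thus
  -- at most k times.
  sumOver-covered : ∀ B {k Is} → All (λ I → 0ℚ ℚ.≤ c I) Is → All (λ I → ∣ I ∩ B ∣ ≤ k) Is →
    sumOver B (covered Is) ℚ.≤ ι k ℚ.* sumℚ (map c Is)
  sumOver-covered B {k} [] [] = ℚ.≤-reflexive (trans (sumOver-zero B) (sym (ℚ.*-zeroʳ (ι k))))
  sumOver-covered B {k} {I ∷ Is} (0≤c ∷ 0≤cs) (I≤k ∷ Is≤k) = begin
    sumOver B (covered (I ∷ Is))                                   ≡⟨ sumOver-cong B (covered-∷ I Is) ⟩
    sumOver B (λ e → charge I (c I) e ℚ.+ covered Is e)            ≡⟨ sumOver-+ B (charge I (c I)) (covered Is) ⟩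
    sumOver B (charge I (c I)) ℚ.+ sumOver B (covered Is)          ≡⟨ cong (ℚ._+ sumOver B (covered Is)) (sumOver-charge I B (c I)) ⟩
    ι ∣ I ∩ B ∣ ℚ.* c I ℚ.+ sumOver B (covered Is)                 ≤⟨ ℚ.+-mono-≤ (ι-*-mono 0≤c I≤k) (sumOver-covered B 0≤cs Is≤k) ⟩
    ι k ℚ.* c I ℚ.+ ι k ℚ.* sumℚ (map c Is)                        ≡⟨ ℚ.*-distribˡ-+ (ι k) (c I) _ ⟨
    ι k ℚ.* sumℚ (map c (I ∷ Is))                                  ∎
    where open ℚ.≤-Reasoning

-- Validity and height for partition matroids

module _ {n m : ℕ} (M : PartitionMatroid n m) {g : Fin n → ℚ} (cbgt : IsCBGT (independent? M) g) where
  open IsCBGT cbgt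

  members-independent : All (Independent M) members
  members-independent = All.all-filter (independent? M) (subsets n)

  coeff-nonNeg : All (λ I → 0ℚ ℚ.≤ coeff I) members
  coeff-nonNeg = All.map (λ {I} → λ-nonNeg I) members-independent

  rate≤1 : ∀ e → g e ℚ.≤ 1ℚ
  rate≤1 e = subst₂ ℚ._≤_ (sym (λ-rate e)) λ-sum (covered≤total coeff coeff-nonNeg e)

  -- An empty family would have coefficient sum 0 instead of 1, so an independent set exists, and
  -- the size of its intersection with the block excludes a negative capacity.
  capacity-ℕ : ∀ j → ∃[ k ] capacity M j ≡ + k
  capacity-ℕ j with members | members-independent | λ-sum
  ... | []    | []      | ()
  ... | I ∷ _ | ind ∷ _ | _ with capacity M j | ind j
  ... | + k | _ = k , refl

  block-rate : ∀ j {k} → capacity M j ≡ + k → sumOver (block M j) g ℚ.≤ ι k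
  block-rate j {k} eq = subst₂ ℚ._≤_ (sumOver-cong (block M j) (sym ∘ λ-rate))
    (trans (cong (ι k ℚ.*_) λ-sum) (ℚ.*-identityʳ (ι k)))
    (sumOver-covered coeff (block M j) coeff-nonNeg
      (All.map (λ ind → ℤ.drop‿+≤+ (subst (_ ℤ.≤_) eq (ind j))) members-independent))

  rotors : List Rotor
  rotors = packAll (block M) (level ∘ g) []

  schedule-valid : Valid (Independent M) (schedule rotors)
  schedule-valid t j with capacity-ℕ j
  ... | k , eq = subst (_ ℤ.≤_) (sym eq) (ℤ.+≤+ (begin
    ∣ cut (turns t rotors) ⊥ ∩ B ∣           ≤⟨ cut-∩ (turns t rotors) ⊥ B ⟩
    ∣ ⊥ ∩ B ∣ + busy P (turns t rotors)      ≡⟨ cong₂ _+_ (trans (cong ∣_∣ (∩-zeroˡ B)) (∣⊥∣≡0 n)) (busy-turns P t rotors) ⟩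
    busy P rotors                            ≤⟨ packAll-busy P (block M) (level ∘ g) [] j avoid (ℚ.≤-trans (sumOver-mono B (weight-level ∘ g-nonNeg)) (block-rate j eq)) ⟩
    k + 0                                    ≡⟨ +-identityʳ k ⟩
    k                                        ∎))
    where
    open ≤-Reasoning
    B = block M j
    P = member B
    avoid : ∀ j′ → j′ ≢ j → ∀ {e} → e ∈ block M j′ → P (toℕ e) ≡ false
    avoid j′ j′≢j {e} e∈ with P (toℕ e) in eqP
    ... | false = refl
    ... | true with isPartition M e
    ...   | _ , _ , unique = ⊥-elim (j′≢j (trans (sym (unique e∈)) (unique (member⇒∈ eqP))))

  schedule-height : HeightAtMost g (schedule rotors) (ι 2)
  schedule-height e t with level (g e) in eq
  -- A bamboo without an exponent has rate 0; it is not planted and stays at height 0.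
  ... | nothing = subst (ℚ._≤ ι 2) (sym (height-uncut g (schedule rotors) (level-nothing (g-nonNeg e) eq) t)) (ι-nonNeg 2)
  ... | just a with isPartition M e
  ...   | j , e∈ , _ = ℚ.≤-trans
    (height-bound g rotors (g-nonNeg e) (packAll-adds (block M) (level ∘ g) [] j e∈ eq) t)
    (level-upper (g-nonNeg e) eq (rate≤1 e))

-- The program and its cost calculus.  Comments in the function bodies list the
-- environment, variable 0 first.

pattern LESS    = Fin.zero
pattern DOUBLE  = Fin.suc LESS
pattern EXP     = Fin.suc DOUBLE
pattern PUT     = Fin.suc EXP
pattern INSERT  = Fin.suc PUT
pattern PACK    = Fin.suc INSERT
pattern PACKALL = Fin.suc PACK
pattern ZEROS   = Fin.suc PACKALL
pattern TURN    = Fin.suc ZEROS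
pattern MARK    = Fin.suc TURN
pattern CUT     = Fin.suc MARK

arities : Fin 11 → ℕ
arities LESS    = 3
arities DOUBLE  = 1
arities EXP     = 2
arities PUT     = 2
arities INSERT  = 3
arities PACK    = 5
arities PACKALL = 3
arities ZEROS   = 1
arities TURN    = 1
arities MARK    = 2
arities CUT     = 2

v : ∀ i {n} {i<n : True (i <? n)} → Expr arities n
v i {n} {i<n} = var (#_ i {n} {i<n})

true′ : ∀ {n} → Expr arities n
true′ = cons nil nil

node′ : ∀ {n} → Expr arities n → Expr arities n → Expr arities n
node′ l r = cons (cons nil l) r

bodies : (f : Fin 11) → Expr arities (arities f)
bodies LESS =                                   -- b x y
  case (v 1)
    (case (v 2) (v 0) true′)
    (case (v 4)                                 -- d x′ b x y
      nil
      (let′                                     -- e y′ d x′ b x y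
        (case (v 2)
          (case (v 0) (v 4) true′)
          (case (v 2) nil (v 8)))
        (call LESS (v 0 ∷ v 4 ∷ v 2 ∷ []))))
bodies DOUBLE =                                 -- x
  case (v 0)
    nil
    (case (v 0)                                 -- d x′ x
      (cons true′ (call DOUBLE (v 1 ∷ [])))
      (cons true′ (cons nil (v 3))))
bodies EXP =                                    -- x y
  let′ (call LESS (true′ ∷ v 1 ∷ v 0 ∷ []))
    (case (v 0)                                 -- t x y
      (let′ (call DOUBLE (v 1 ∷ []))
        (cons nil (call EXP (v 0 ∷ v 3 ∷ []))))
      nil)
bodies PUT =                                    -- s (ss , c)
  case (v 1)
    nil
    (case (v 1)                                 -- ss c s _
      (cons (node′ (v 2) (v 0)) nil)
      (case (v 4)                               -- _ _ ss c s _
        (cons (node′ (v 3) (v 2)) nil)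
        (cons (node′ nil (v 4)) (node′ (v 6) (v 5)))))
bodies INSERT =                                 -- a x ss
  case (v 0)
    (cons (v 2) (v 1))
    (case (v 4)                                 -- _ a′ a x ss
      (let′ (call INSERT (v 1 ∷ v 3 ∷ nil ∷ []))
        (call PUT (nil ∷ v 0 ∷ [])))
      (case (v 0)                               -- h ss′ _ a′ a x ss
        nil
        (let′                                   -- _ s h ss′ _ a′ a x ss
          (call INSERT (v 5 ∷ v 7 ∷ v 3 ∷ []))
          (call PUT (v 2 ∷ v 0 ∷ [])))))
bodies PACK =                                   -- i p rs ss ts
  case (v 1)
    (cons (v 3) (v 4))
    (case (v 4)                                 -- b p′ i p rs ss ts
      nil
      (case (v 2)                               -- r rs′ b p′ i p rs ss ts
        (call PACK (cons nil (v 4) ∷ v 3 ∷ v 1 ∷ v 7 ∷ v 8 ∷ []))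
        (case (v 2)
          nil
          (case (v 0)                           -- num den _ _ r rs′ b p′ i p rs ss ts
            nil
            (case (v 1)                         -- sign abs num den _ _ r rs′ b p′ i p rs ss ts
              (call PACK (cons nil (v 10) ∷ v 9 ∷ v 7 ∷ v 13 ∷ v 14 ∷ []))
              (let′ (call EXP (v 3 ∷ v 5 ∷ []))
                (let′ (call INSERT (v 0 ∷ cons nil (v 13) ∷ v 16 ∷ []))
                  (case (v 0)
                    nil
                    (call PACK (cons nil (v 16) ∷ v 15 ∷ v 13 ∷ v 0 ∷ cons (v 1) (v 20) ∷ []))))))))))
bodies PACKALL =                                -- bs rs ts
  case (v 0)
    (v 2)
    (case (v 0)                                 -- b bs′ bs rs ts
      nil
      (let′                                     -- p _ b bs′ bs rs ts
        (call PACK (nil ∷ v 0 ∷ v 5 ∷ nil ∷ v 6 ∷ []))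
        (call PACKALL (v 4 ∷ v 6 ∷ v 0 ∷ []))))
bodies ZEROS =                                  -- rs
  case (v 0)
    nil
    (cons nil (call ZEROS (v 1 ∷ [])))
bodies TURN =                                   -- t
  case (v 0)
    (cons nil nil)
    (case (v 0)                                 -- h r t
      -- `just i` as the firing and `leaf i` as the rotor have the same code, so the input serves as
      -- both results.
      (cons (v 2) (v 2))
      (let′ (call TURN (v 1 ∷ []))              -- _ l h r t
        (case (v 0)
          nil
          (cons (v 0) (node′ (v 6) (v 1))))))
bodies MARK =                                   -- i p
  case (v 1)
    nil
    (case (v 2)                                 -- b p′ i p
      (cons true′ (v 1))
      (cons (v 2) (call MARK (v 1 ∷ v 3 ∷ []))))
bodies CUT =                                    -- ts p
  case (v 0)
    (cons (v 1) nil)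
    (let′ (call TURN (v 0 ∷ []))                -- t ts′ ts p
      (case (v 0)
        nil
        (let′                                   -- o t′ _ t ts′ ts p
          (case (v 0) (v 6) (call MARK (v 1 ∷ v 8 ∷ [])))
          (let′ (call CUT (v 5 ∷ v 0 ∷ []))
            (case (v 0)
              nil
              (cons (v 0) (cons (v 5) (v 1))))))))

trimming : Program
trimming = record { numFuns = 11 ; arity = arities ; body = bodies }

-- The state pairs the code of the empty set, built once with the length of the list of rates, with
-- the rotors. Each day marks the fired bamboos in that empty set.
trimmer : Algorithm
trimmer = record
  { program    = trimming
  ; preprocess = case (v 0) nil (cons (call ZEROS (v 1 ∷ [])) (call PACKALL (v 0 ∷ v 1 ∷ nil ∷ [])))
  ; next       = case (v 0) nil
      (let′ (call CUT (v 1 ∷ v 0 ∷ []))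
        (case (v 0) nil (cons (v 0) (cons (v 3) (v 1)))))
  }

open Semantics trimming

mutual
  ∥_∥ : ∀ {n} → Expr arities n → ℕ
  ∥ var _ ∥        = 1
  ∥ nil ∥          = 1
  ∥ cons e₁ e₂ ∥   = suc (∥ e₁ ∥ + ∥ e₂ ∥)
  ∥ case e e₁ e₂ ∥ = suc (∥ e ∥ + (∥ e₁ ∥ ⊔ ∥ e₂ ∥))
  ∥ let′ e₁ e₂ ∥   = suc (∥ e₁ ∥ + ∥ e₂ ∥)
  ∥ call _ es ∥    = suc ∥ es ∥*

  ∥_∥* : ∀ {n l} → Vec (Expr arities n) l → ℕ
  ∥ [] ∥*     = 0
  ∥ e ∷ es ∥* = ∥ e ∥ + ∥ es ∥*

-- The total cost is at most the size of the expression, which accounts for the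
-- rules applied outside of calls, plus the cost c of the called functions.
infix 4 _⊢_↓_[_] _⊢_↓*_[_]

record _⊢_↓_[_] {n} (ρ : Vec Tree n) (e : Expr arities n) (u : Tree) (c : ℕ) : Set where
  constructor _,_
  field
    {total}    : ℕ
    derivation : ρ ⊢ e ⇓ u ⟨ total ⟩
    total≤     : total ≤ ∥ e ∥ + c

record _⊢_↓*_[_] {n l} (ρ : Vec Tree n) (es : Vec (Expr arities n) l) (us : Vec Tree l) (c : ℕ) : Set where
  constructor _,_
  field
    {total}    : ℕ
    derivation : ρ ⊢ es ⇓* us ⟨ total ⟩
    total≤     : total ≤ ∥ es ∥* + c

record Run (f : Fin 11) (us : Vec Tree (arities f)) (u : Tree) (c : ℕ) : Set where
  constructor _,_
  field
    {total}    : ℕ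
    derivation : us ⊢ bodies f ⇓ u ⟨ total ⟩
    total≤     : total ≤ c

add-costs : ∀ s₁ s₂ {k₁ k₂ c₁ c₂} → k₁ ≤ s₁ + c₁ → k₂ ≤ s₂ + c₂ → k₁ + k₂ ≤ s₁ + s₂ + (c₁ + c₂)
add-costs s₁ s₂ {c₁ = c₁} {c₂} p q = ≤-trans (+-mono-≤ p q) (≤-reflexive (+-interchange s₁ c₁ s₂ c₂))

module _ {n} {ρ : Vec Tree n} where

  var↓ : ∀ {x} → ρ ⊢ var x ↓ Vec.lookup ρ x [ 0 ]
  var↓ = var , ≤-refl

  nil↓ : ρ ⊢ nil ↓ nil [ 0 ]
  nil↓ = nil , ≤-refl

  cons↓ : ∀ {e₁ e₂ u₁ u₂ c₁ c₂} → ρ ⊢ e₁ ↓ u₁ [ c₁ ] → ρ ⊢ e₂ ↓ u₂ [ c₂ ] → ρ ⊢ cons e₁ e₂ ↓ cons u₁ u₂ [ c₁ + c₂ ]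
  cons↓ {e₁} {e₂} (d₁ , p₁) (d₂ , p₂) = cons d₁ d₂ , s≤s (add-costs ∥ e₁ ∥ ∥ e₂ ∥ p₁ p₂)

  nil-case↓ : ∀ {e e₁ e₂ u c₁ c₂} → ρ ⊢ e ↓ nil [ c₁ ] → ρ ⊢ e₁ ↓ u [ c₂ ] → ρ ⊢ case e e₁ e₂ ↓ u [ c₁ + c₂ ]
  nil-case↓ {e} {e₁} {e₂} {c₂ = c₂} (d₁ , p₁) (d₂ , p₂) =
    case-nil d₁ d₂ , s≤s (add-costs ∥ e ∥ (∥ e₁ ∥ ⊔ ∥ e₂ ∥) p₁ (≤-trans p₂ (+-monoˡ-≤ c₂ (m≤m⊔n ∥ e₁ ∥ ∥ e₂ ∥))))

  cons-case↓ : ∀ {e e₁ e₂ u₁ u₂ u c₁ c₂} →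
    ρ ⊢ e ↓ cons u₁ u₂ [ c₁ ] → (u₁ ∷ u₂ ∷ ρ) ⊢ e₂ ↓ u [ c₂ ] → ρ ⊢ case e e₁ e₂ ↓ u [ c₁ + c₂ ]
  cons-case↓ {e} {e₁} {e₂} {c₂ = c₂} (d₁ , p₁) (d₂ , p₂) =
    case-cons d₁ d₂ , s≤s (add-costs ∥ e ∥ (∥ e₁ ∥ ⊔ ∥ e₂ ∥) p₁ (≤-trans p₂ (+-monoˡ-≤ c₂ (m≤n⊔m ∥ e₁ ∥ ∥ e₂ ∥))))

  let↓ : ∀ {e₁ e₂ u₁ u c₁ c₂} → ρ ⊢ e₁ ↓ u₁ [ c₁ ] → (u₁ ∷ ρ) ⊢ e₂ ↓ u [ c₂ ] → ρ ⊢ let′ e₁ e₂ ↓ u [ c₁ + c₂ ]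
  let↓ {e₁} {e₂} (d₁ , p₁) (d₂ , p₂) = let′ d₁ d₂ , s≤s (add-costs ∥ e₁ ∥ ∥ e₂ ∥ p₁ p₂)

  []↓ : ρ ⊢ [] ↓* [] [ 0 ]
  []↓ = [] , z≤n

  infixr 5 _∷↓_
  _∷↓_ : ∀ {l e u c₁ c₂} {es : Vec (Expr arities n) l} {us} →
    ρ ⊢ e ↓ u [ c₁ ] → ρ ⊢ es ↓* us [ c₂ ] → ρ ⊢ (e ∷ es) ↓* (u ∷ us) [ c₁ + c₂ ]
  _∷↓_ {e = e} {es = es} (d₁ , p₁) (d₂ , p₂) = (d₁ ∷ d₂) , add-costs ∥ e ∥ ∥ es ∥* p₁ p₂

  call↓ : ∀ {f es us u c₁ c₂} → ρ ⊢ es ↓* us [ c₁ ] → Run f us u c₂ → ρ ⊢ call f es ↓ u [ c₁ + c₂ ]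
  call↓ {es = es} {c₁ = c₁} (d₁ , p₁) (d₂ , p₂) =
    call d₁ d₂ , s≤s (≤-trans (+-mono-≤ p₁ p₂) (≤-reflexive (+-assoc ∥ es ∥* c₁ _)))

run-weaken : ∀ {f us u c c′} → c ≤ c′ → Run f us u c → Run f us u c′
run-weaken c≤ (d , p) = d , ≤-trans p c≤

-- Any bound on the sizes of the function bodies would do.
maxSize : ℕ
maxSize = 200

∥bodies∥≤ : ∀ f → ∥ bodies f ∥ ≤ maxSize
∥bodies∥≤ = toWitness {a? = Fin.all? (λ f → ∥ bodies f ∥ ≤? maxSize)} _

-- Evaluation of the program

-- Unary is affordable: bamboo indices are below n, and exponents are at most the number of digits
-- of a denominator plus one.
⌜_⌝unary : ℕ → Tree
⌜ zero  ⌝unary = nil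
⌜ suc i ⌝unary = cons nil ⌜ i ⌝unary

-- A `nil` head marks a leaf. The left child of a node is wrapped in a further `cons`, since it may
-- be `idle`, whose own code is `nil`.
⌜_⌝rotor : Rotor → Tree
⌜ idle     ⌝rotor = nil
⌜ leaf i   ⌝rotor = cons nil ⌜ i ⌝unary
⌜ node l r ⌝rotor = cons (cons nil ⌜ l ⌝rotor) ⌜ r ⌝rotor

⌜_⌝rotors : List Rotor → Tree
⌜ ts ⌝rotors = ⌜ map ⌜_⌝rotor ts ⌝list

⌜_⌝fired : Maybe ℕ → Tree
⌜_⌝fired = maybe (λ i → cons nil ⌜ i ⌝unary) nil

+-assoc₃ : ∀ w a b c → w + (a + (b + c)) ≡ w + (a + b) + c
+-assoc₃ w a b c = trans (cong (_+_ w) (sym (+-assoc a b c))) (sym (+-assoc w (a + b) c))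

module Costs (W : ℕ) (maxSize≤W : maxSize ≤ W) where

  -- Every activation is charged a flat W for its own rules, so a cost bound reduces to counting
  -- activations.
  fn : ∀ {f us u c C} → us ⊢ bodies f ↓ u [ c ] → W + c ≤ C → Run f us u C
  fn {f} {c = c} (d , p) le = d , ≤-trans p (≤-trans (+-monoˡ-≤ c (≤-trans (∥bodies∥≤ f) maxSize≤W)) le)

  W+0≤ : ∀ x → W + 0 ≤ W + x
  W+0≤ x = +-monoʳ-≤ W z≤n

  run-less : ∀ b x y → Run LESS (⌜ b ⌝bool ∷ ⌜ x ⌝ℕᵇ ∷ ⌜ y ⌝ℕᵇ ∷ []) ⌜ less b x y ⌝bool (suc (ℕᵇ.size x) * W)
  run-less b ℕᵇ.zero  ℕᵇ.zero  = fn (nil-case↓ var↓ (nil-case↓ var↓ var↓)) ≤-refl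
  run-less b ℕᵇ.zero  2[1+ y ] = fn (nil-case↓ var↓ (cons-case↓ var↓ (cons↓ nil↓ nil↓))) ≤-refl
  run-less b ℕᵇ.zero  1+[2 y ] = fn (nil-case↓ var↓ (cons-case↓ var↓ (cons↓ nil↓ nil↓))) ≤-refl
  run-less b 2[1+ x ] ℕᵇ.zero  = fn (cons-case↓ var↓ (nil-case↓ var↓ nil↓)) (W+0≤ _)
  run-less b 1+[2 x ] ℕᵇ.zero  = fn (cons-case↓ var↓ (nil-case↓ var↓ nil↓)) (W+0≤ _)
  run-less b 2[1+ x ] 2[1+ y ] = fn (cons-case↓ var↓ (cons-case↓ var↓
    (let↓ (cons-case↓ var↓ (cons-case↓ var↓ var↓)) (call↓ (var↓ ∷↓ var↓ ∷↓ var↓ ∷↓ []↓) (run-less b x y))))) ≤-refl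
  run-less b 2[1+ x ] 1+[2 y ] = fn (cons-case↓ var↓ (cons-case↓ var↓
    (let↓ (cons-case↓ var↓ (nil-case↓ var↓ nil↓)) (call↓ (var↓ ∷↓ var↓ ∷↓ var↓ ∷↓ []↓) (run-less false x y))))) ≤-refl
  run-less b 1+[2 x ] 2[1+ y ] = fn (cons-case↓ var↓ (cons-case↓ var↓
    (let↓ (nil-case↓ var↓ (cons-case↓ var↓ (cons↓ nil↓ nil↓))) (call↓ (var↓ ∷↓ var↓ ∷↓ var↓ ∷↓ []↓) (run-less true x y))))) ≤-refl
  run-less b 1+[2 x ] 1+[2 y ] = fn (cons-case↓ var↓ (cons-case↓ var↓
    (let↓ (nil-case↓ var↓ (nil-case↓ var↓ var↓)) (call↓ (var↓ ∷↓ var↓ ∷↓ var↓ ∷↓ []↓) (run-less b x y))))) ≤-refl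

  run-double : ∀ x → Run DOUBLE (⌜ x ⌝ℕᵇ ∷ []) ⌜ ℕᵇ.double x ⌝ℕᵇ (suc (ℕᵇ.size x) * W)
  run-double ℕᵇ.zero  = fn (nil-case↓ var↓ nil↓) ≤-refl
  run-double 2[1+ x ] = fn (cons-case↓ var↓ (cons-case↓ var↓ (cons↓ (cons↓ nil↓ nil↓) (cons↓ nil↓ var↓)))) (W+0≤ _)
  run-double 1+[2 x ] = fn (cons-case↓ var↓ (nil-case↓ var↓
    (cons↓ (cons↓ nil↓ nil↓) (call↓ (var↓ ∷↓ []↓) (run-double x))))) ≤-refl

  run-mark : ∀ {n} i (p : Subset n) → Run MARK (⌜ i ⌝unary ∷ ⌜ p ⌝subset ∷ []) ⌜ mark i p ⌝subset (suc n * W)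
  run-mark i       []      = fn (nil-case↓ var↓ nil↓) ≤-refl
  run-mark zero    (b ∷ p) = fn (cons-case↓ var↓ (nil-case↓ var↓ (cons↓ (cons↓ nil↓ nil↓) var↓))) (W+0≤ _)
  run-mark (suc i) (b ∷ p) = fn (cons-case↓ var↓ (cons-case↓ var↓
    (cons↓ var↓ (call↓ (var↓ ∷↓ var↓ ∷↓ []↓) (run-mark i p))))) ≤-refl

  run-zeros : ∀ {n} (f : Fin n → Tree) → Run ZEROS (⌜ tabulate f ⌝list ∷ []) ⌜ ⊥ {n} ⌝subset (suc n * W)
  run-zeros {zero}  f = fn (nil-case↓ var↓ nil↓) ≤-refl
  run-zeros {suc n} f = fn (cons-case↓ var↓ (cons↓ nil↓ (call↓ (var↓ ∷↓ []↓) (run-zeros (f ∘ Fin.suc))))) ≤-refl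

  -- Only the left branch is descended and right children are shared, so the cost follows the depth
  -- and not the number of leaves.
  run-turn : ∀ t → Run TURN (⌜ t ⌝rotor ∷ []) (cons ⌜ fired t ⌝fired ⌜ turn t ⌝rotor) (suc (depth t) * W)
  run-turn idle       = fn (nil-case↓ var↓ (cons↓ nil↓ nil↓)) ≤-refl
  run-turn (leaf i)   = fn (cons-case↓ var↓ (nil-case↓ var↓ (cons↓ var↓ var↓))) ≤-refl
  run-turn (node l r) = fn (cons-case↓ var↓ (cons-case↓ var↓
    (let↓ (call↓ (var↓ ∷↓ []↓) (run-turn l)) (cons-case↓ var↓ (cons↓ var↓ (cons↓ (cons↓ nil↓ var↓) var↓))))))
    (+-monoʳ-≤ W (≤-trans (≤-reflexive (+-identityʳ _)) (*-monoˡ-≤ W (s≤s (m≤m⊔n (depth l) (depth r))))))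

  run-put : ∀ s ss c → Run PUT (⌜ s ⌝rotor ∷ cons ⌜ spine ss ⌝rotor ⌜ c ⌝rotor ∷ [])
    (cons ⌜ spine (proj₁ (put s ss c)) ⌝rotor ⌜ proj₂ (put s ss c) ⌝rotor) W
  run-put s ss idle = fn (cons-case↓ var↓ (nil-case↓ var↓ (cons↓ (cons↓ (cons↓ nil↓ var↓) var↓) nil↓))) (≤-reflexive (+-identityʳ W))
  run-put idle ss (leaf _) = fn (cons-case↓ var↓ (cons-case↓ var↓ (nil-case↓ var↓
    (cons↓ (cons↓ (cons↓ nil↓ var↓) var↓) nil↓)))) (≤-reflexive (+-identityʳ W))
  run-put idle ss (node _ _) = fn (cons-case↓ var↓ (cons-case↓ var↓ (nil-case↓ var↓
    (cons↓ (cons↓ (cons↓ nil↓ var↓) var↓) nil↓)))) (≤-reflexive (+-identityʳ W))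
  run-put (leaf _) ss (leaf _) = fn (cons-case↓ var↓ (cons-case↓ var↓ (cons-case↓ var↓
    (cons↓ (cons↓ (cons↓ nil↓ nil↓) var↓) (cons↓ (cons↓ nil↓ var↓) var↓))))) (≤-reflexive (+-identityʳ W))
  run-put (leaf _) ss (node _ _) = fn (cons-case↓ var↓ (cons-case↓ var↓ (cons-case↓ var↓
    (cons↓ (cons↓ (cons↓ nil↓ nil↓) var↓) (cons↓ (cons↓ nil↓ var↓) var↓))))) (≤-reflexive (+-identityʳ W))
  run-put (node _ _) ss (leaf _) = fn (cons-case↓ var↓ (cons-case↓ var↓ (cons-case↓ var↓
    (cons↓ (cons↓ (cons↓ nil↓ nil↓) var↓) (cons↓ (cons↓ nil↓ var↓) var↓))))) (≤-reflexive (+-identityʳ W))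
  run-put (node _ _) ss (node _ _) = fn (cons-case↓ var↓ (cons-case↓ var↓ (cons-case↓ var↓
    (cons↓ (cons↓ (cons↓ nil↓ nil↓) var↓) (cons↓ (cons↓ nil↓ var↓) var↓))))) (≤-reflexive (+-identityʳ W))

  run-insert : ∀ a x ss → Run INSERT (⌜ a ⌝unary ∷ ⌜ x ⌝rotor ∷ ⌜ spine ss ⌝rotor ∷ [])
    (cons ⌜ spine (proj₁ (insert a x ss)) ⌝rotor ⌜ proj₂ (insert a x ss) ⌝rotor) (suc a * (W + W))
  run-insert zero x ss = fn (nil-case↓ var↓ (cons↓ var↓ var↓)) (≤-trans (+-monoʳ-≤ W z≤n) (≤-reflexive (sym (+-identityʳ (W + W)))))
  run-insert (suc a) x [] = fn (cons-case↓ var↓ (nil-case↓ var↓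
    (let↓ (call↓ (var↓ ∷↓ var↓ ∷↓ nil↓ ∷↓ []↓) (run-insert a x []))
      (call↓ (nil↓ ∷↓ var↓ ∷↓ []↓) (run-put idle (proj₁ (insert a x [])) (proj₂ (insert a x [])))))))
    (≤-reflexive (trans (cong (_+_ W) (+-comm (suc a * (W + W)) W)) (sym (+-assoc W W (suc a * (W + W))))))
  run-insert (suc a) x (s ∷ ss) = fn (cons-case↓ var↓ (cons-case↓ var↓ (cons-case↓ var↓
    (let↓ (call↓ (var↓ ∷↓ var↓ ∷↓ var↓ ∷↓ []↓) (run-insert a x ss))
      (call↓ (var↓ ∷↓ var↓ ∷↓ []↓) (run-put s (proj₁ (insert a x ss)) (proj₂ (insert a x ss))))))))
    (≤-reflexive (trans (cong (_+_ W) (+-comm (suc a * (W + W)) W)) (sym (+-assoc W W (suc a * (W + W))))))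

  -- The program has no fuel. The hypothesis guarantees that its test succeeds before the fuel of
  -- `exponent` runs out, so the two agree.
  run-exp : ∀ fuel x y → ℕᵇ.toℕ y ≤ 2 ^ fuel * ℕᵇ.toℕ x → let L = suc (ℕᵇ.size y) * W in
    Run EXP (⌜ x ⌝ℕᵇ ∷ ⌜ y ⌝ℕᵇ ∷ []) ⌜ exponent fuel x y ⌝unary (suc fuel * (W + (L + L)))
  run-exp zero x y y≤x with less true y x in eq | run-less true y x
  ... | true  | r = fn (let↓ (call↓ (cons↓ nil↓ nil↓ ∷↓ var↓ ∷↓ var↓ ∷↓ []↓) r) (cons-case↓ var↓ nil↓))
    (≤-trans (+-monoʳ-≤ W (+-monoʳ-≤ (suc (ℕᵇ.size y) * W) z≤n)) (m≤m+n _ _))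
  ... | false | r = ⊥-elim (<⇒≱ (ℕᵇ.toℕ-mono-< (less-false y x eq)) (≤-trans y≤x (≤-reflexive (+-identityʳ _))))
  run-exp (suc fuel) x y y≤x with less true y x in eq | run-less true y x
  ... | true  | r = fn (let↓ (call↓ (cons↓ nil↓ nil↓ ∷↓ var↓ ∷↓ var↓ ∷↓ []↓) r) (cons-case↓ var↓ nil↓))
    (≤-trans (+-monoʳ-≤ W (+-monoʳ-≤ (suc (ℕᵇ.size y) * W) z≤n)) (m≤m+n _ _))
  ... | false | r = fn
    (let↓ (call↓ (cons↓ nil↓ nil↓ ∷↓ var↓ ∷↓ var↓ ∷↓ []↓) r) (nil-case↓ var↓
      (let↓ (call↓ (var↓ ∷↓ []↓) (run-weaken (*-monoˡ-≤ W (s≤s (size-mono-< (less-false y x eq)))) (run-double x)))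
        (cons↓ nil↓ (call↓ (var↓ ∷↓ var↓ ∷↓ []↓)
          (run-exp fuel (ℕᵇ.double x) y (subst (ℕᵇ.toℕ y ≤_) (sym (shift-double fuel x)) y≤x)))))))
    (≤-reflexive (+-assoc₃ W (suc (ℕᵇ.size y) * W) (suc (ℕᵇ.size y) * W) _))

  costExp costInsert costPack : ℕ
  costExp    = W * (W + (W * W + W * W))
  costInsert = W * (W + W)
  costPack   = W + (costExp + costInsert)

  Short : ℕᵇ → Set
  Short y = suc (suc (ℕᵇ.size y)) ≤ W

  run-level : ∀ x y {a} → Short y → ratioLevel x y ≡ just a →
    Run EXP (⌜ x ⌝ℕᵇ ∷ ⌜ y ⌝ℕᵇ ∷ []) ⌜ a ⌝unary costExp
  run-level x y short eq = go x eq
    where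
    L≤ : suc (ℕᵇ.size y) * W ≤ W * W
    L≤ = *-monoˡ-≤ W (<⇒≤ short)
    cost≤ : suc (suc (ℕᵇ.size y)) * (W + (suc (ℕᵇ.size y) * W + suc (ℕᵇ.size y) * W)) ≤ costExp
    cost≤ = *-mono-≤ short (+-monoʳ-≤ W (+-mono-≤ L≤ L≤))
    go : ∀ x {a} → ratioLevel x y ≡ just a → Run EXP (⌜ x ⌝ℕᵇ ∷ ⌜ y ⌝ℕᵇ ∷ []) ⌜ a ⌝unary costExp
    go x@(2[1+ _ ]) refl = run-weaken cost≤ (run-exp (suc (ℕᵇ.size y)) x y (fuel-enough x y (s≤s z≤n)))
    go x@(1+[2 _ ]) refl = run-weaken cost≤ (run-exp (suc (ℕᵇ.size y)) x y (fuel-enough x y (s≤s z≤n)))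

  run-insert-level : ∀ x y i ss {a} → Short y → ratioLevel x y ≡ just a →
    Run INSERT (⌜ a ⌝unary ∷ ⌜ leaf i ⌝rotor ∷ ⌜ spine ss ⌝rotor ∷ [])
      (cons ⌜ spine (proj₁ (insert a (leaf i) ss)) ⌝rotor ⌜ proj₂ (insert a (leaf i) ss) ⌝rotor) costInsert
  run-insert-level x y i ss {a} short eq =
    run-weaken (*-monoˡ-≤ (W + W) (≤-trans (s≤s (ratioLevel-size x y eq)) short)) (run-insert a (leaf i) ss)

  module _ {n} (i : ℕ) (p : Subset n) (rates : Tree) (lv : Fin n → Maybe ℕ) {C : ℕ} where

    -- The numerator is a variable here, so that matching on its digits reduces both its code and
    -- `ratioLevel`; in `run-pack` it is a value of `ℕᵇ.fromℕ`, on which no match is possible.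
    run-pack-step : ∀ {z sgn} x y ss ts → z ≡ cons sgn ⌜ x ⌝ℕᵇ → Short y →
      (∀ ss ts → Run PACK (⌜ suc i ⌝unary ∷ ⌜ p ⌝subset ∷ rates ∷ ⌜ spine ss ⌝rotor ∷ ⌜ ts ⌝rotors ∷ [])
                   ⌜ pack (suc i) p lv ss ts ⌝rotors C) →
      Run PACK (⌜ i ⌝unary ∷ ⌜ true ∷ p ⌝subset ∷ cons (cons z ⌜ y ⌝ℕᵇ) rates ∷ ⌜ spine ss ⌝rotor ∷ ⌜ ts ⌝rotors ∷ [])
        ⌜ pack (suc i) p lv (proj₁ (plant (ratioLevel x y) i ss ts)) (proj₂ (plant (ratioLevel x y) i ss ts)) ⌝rotors
        (costPack + C)
    run-pack-step ℕᵇ.zero y ss ts refl short rec = fn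
      (cons-case↓ var↓ (cons-case↓ var↓ (cons-case↓ var↓ (cons-case↓ var↓ (cons-case↓ var↓ (nil-case↓ var↓
        (call↓ (cons↓ nil↓ var↓ ∷↓ var↓ ∷↓ var↓ ∷↓ var↓ ∷↓ var↓ ∷↓ []↓) (rec ss ts))))))))
      (+-monoˡ-≤ C (m≤m+n W _))
    run-pack-step x@(2[1+ _ ]) y ss ts refl short rec = fn
      (cons-case↓ var↓ (cons-case↓ var↓ (cons-case↓ var↓ (cons-case↓ var↓ (cons-case↓ var↓ (cons-case↓ var↓
        (let↓ (call↓ (var↓ ∷↓ var↓ ∷↓ []↓) (run-level x y short refl))
        (let↓ (call↓ (var↓ ∷↓ cons↓ nil↓ var↓ ∷↓ var↓ ∷↓ []↓) (run-insert-level x y i ss short refl))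
        (cons-case↓ var↓
          (call↓ (cons↓ nil↓ var↓ ∷↓ var↓ ∷↓ var↓ ∷↓ var↓ ∷↓ cons↓ var↓ var↓ ∷↓ []↓)
            (rec (proj₁ (plant (ratioLevel x y) i ss ts)) (proj₂ (plant (ratioLevel x y) i ss ts)))))))))))))
      (≤-reflexive (+-assoc₃ W costExp costInsert C))
    run-pack-step x@(1+[2 _ ]) y ss ts refl short rec = fn
      (cons-case↓ var↓ (cons-case↓ var↓ (cons-case↓ var↓ (cons-case↓ var↓ (cons-case↓ var↓ (cons-case↓ var↓
        (let↓ (call↓ (var↓ ∷↓ var↓ ∷↓ []↓) (run-level x y short refl))
        (let↓ (call↓ (var↓ ∷↓ cons↓ nil↓ var↓ ∷↓ var↓ ∷↓ []↓) (run-insert-level x y i ss short refl))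
        (cons-case↓ var↓
          (call↓ (cons↓ nil↓ var↓ ∷↓ var↓ ∷↓ var↓ ∷↓ var↓ ∷↓ cons↓ var↓ var↓ ∷↓ []↓)
            (rec (proj₁ (plant (ratioLevel x y) i ss ts)) (proj₂ (plant (ratioLevel x y) i ss ts)))))))))))))
      (≤-reflexive (+-assoc₃ W costExp costInsert C))

  encode-ℤ : ∀ z → ∃[ sgn ] ⌜ z ⌝ℤ ≡ cons sgn ⌜ ℤ.∣ z ∣ ⌝ℕ
  encode-ℤ (+ _)    = _ , refl
  encode-ℤ -[1+ _ ] = _ , refl

  run-pack : ∀ {n} i (p : Subset n) g ss ts → (∀ e → Short (denominator (g e))) →
    Run PACK (⌜ i ⌝unary ∷ ⌜ p ⌝subset ∷ ⌜ tabulate (λ e → ⌜ g e ⌝ℚ) ⌝list ∷ ⌜ spine ss ⌝rotor ∷ ⌜ ts ⌝rotors ∷ [])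
      ⌜ pack i p (level ∘ g) ss ts ⌝rotors (suc n * costPack)
  run-pack i [] g ss ts short = fn (nil-case↓ var↓ (cons↓ var↓ var↓))
    (≤-trans (+-monoʳ-≤ W z≤n) (m≤m+n costPack 0))
  run-pack i (false ∷ p) g ss ts short = fn
    (cons-case↓ var↓ (cons-case↓ var↓ (nil-case↓ var↓
      (call↓ (cons↓ nil↓ var↓ ∷↓ var↓ ∷↓ var↓ ∷↓ var↓ ∷↓ var↓ ∷↓ []↓)
        (run-pack (suc i) p (g ∘ Fin.suc) ss ts (short ∘ Fin.suc))))))
    (+-monoˡ-≤ _ (m≤m+n W _))
  run-pack i (true ∷ p) g ss ts short =
    run-pack-step i p _ (level ∘ g ∘ Fin.suc) (numerator (g Fin.zero)) (denominator (g Fin.zero)) ss ts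
      (proj₂ (encode-ℤ (↥ g Fin.zero))) (short Fin.zero)
      (λ ss ts → run-pack (suc i) p (g ∘ Fin.suc) ss ts (short ∘ Fin.suc))

  run-packAll : ∀ {n m} (B : Fin m → Subset n) (k : Fin m → Tree) g ts → (∀ e → Short (denominator (g e))) →
    Run PACKALL (⌜ tabulate (λ j → cons ⌜ B j ⌝subset (k j)) ⌝list ∷ ⌜ tabulate (λ e → ⌜ g e ⌝ℚ) ⌝list ∷ ⌜ ts ⌝rotors ∷ [])
      ⌜ packAll B (level ∘ g) ts ⌝rotors (suc m * (W + suc n * costPack))
  run-packAll {m = zero} B k g ts short = fn (nil-case↓ var↓ var↓) (≤-trans (+-monoʳ-≤ W z≤n) (m≤m+n _ 0))
  run-packAll {n} {suc m} B k g ts short = fn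
    (cons-case↓ var↓ (cons-case↓ var↓
      (let↓ (call↓ (nil↓ ∷↓ var↓ ∷↓ var↓ ∷↓ nil↓ ∷↓ var↓ ∷↓ []↓) (run-pack 0 (B Fin.zero) g [] ts short))
        (call↓ (var↓ ∷↓ var↓ ∷↓ var↓ ∷↓ []↓)
          (run-packAll (B ∘ Fin.suc) (k ∘ Fin.suc) g (pack 0 (B Fin.zero) (level ∘ g) [] ts) short)))))
    (≤-reflexive (sym (+-assoc W (suc n * costPack) _)))

  costCut : ℕ
  costCut = W + (W * W + W * W)

  run-cut : ∀ {n} ts (p : Subset n) → suc n ≤ W → All (λ t → suc (depth t) ≤ W) ts →
    Run CUT (⌜ ts ⌝rotors ∷ ⌜ p ⌝subset ∷ []) (cons ⌜ cut ts p ⌝subset ⌜ map turn ts ⌝rotors) (suc (length ts) * costCut)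
  run-cut [] p n≤ [] = fn (nil-case↓ var↓ (cons↓ var↓ nil↓)) (≤-trans (+-monoʳ-≤ W z≤n) (m≤m+n _ 0))
  run-cut (t ∷ ts) p n≤ (t≤ ∷ ts≤) with fired t | run-turn t
  ... | nothing | r = fn
    (cons-case↓ var↓ (let↓ (call↓ (var↓ ∷↓ []↓) (run-weaken (*-monoˡ-≤ W t≤) r)) (cons-case↓ var↓
      (let↓ (nil-case↓ var↓ var↓) (let↓ (call↓ (var↓ ∷↓ var↓ ∷↓ []↓) (run-cut ts p n≤ ts≤))
        (cons-case↓ var↓ (cons↓ var↓ (cons↓ var↓ var↓))))))))
    (≤-trans (+-monoʳ-≤ W (+-monoʳ-≤ (W * W) (≤-trans (≤-reflexive (+-identityʳ _)) (m≤n+m _ (W * W)))))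
      (≤-reflexive (+-assoc₃ W (W * W) (W * W) _)))
  ... | just i  | r = fn
    (cons-case↓ var↓ (let↓ (call↓ (var↓ ∷↓ []↓) (run-weaken (*-monoˡ-≤ W t≤) r)) (cons-case↓ var↓
      (let↓ (cons-case↓ var↓ (call↓ (var↓ ∷↓ var↓ ∷↓ []↓) (run-weaken (*-monoˡ-≤ W n≤) (run-mark i p))))
        (let↓ (call↓ (var↓ ∷↓ var↓ ∷↓ []↓) (run-cut ts (mark i p) n≤ ts≤))
        (cons-case↓ var↓ (cons↓ var↓ (cons↓ var↓ var↓))))))))
    (≤-trans (+-monoʳ-≤ W (+-monoʳ-≤ (W * W) (+-monoʳ-≤ (W * W) (≤-reflexive (+-identityʳ _)))))
      (≤-reflexive (+-assoc₃ W (W * W) (W * W) _)))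

-- Polynomial bounds

turns-depth : ∀ {D} t {ts} → All (λ r → depth r ≤ D) ts → All (λ r → depth r ≤ D) (turns t ts)
turns-depth zero    ds = ds
turns-depth (suc t) ds = All.map⁺ (All.map (λ {r} → subst (_≤ _) (sym (depth-turn r))) (turns-depth t ds))

turns-length : ∀ t ts → length (turns t ts) ≡ length ts
turns-length zero    ts = refl
turns-length (suc t) ts = trans (length-map turn (turns t ts)) (turns-length t ts)

size-list : ∀ {n} (f : Fin n → Tree) → suc n ≤ size ⌜ tabulate f ⌝list
size-list {zero}  f = ≤-refl
size-list {suc n} f = s≤s (≤-trans (size-list (f ∘ Fin.suc)) (m≤n+m _ (size (f Fin.zero))))

size-element : ∀ {n} (f : Fin n → Tree) e → size (f e) ≤ size ⌜ tabulate f ⌝list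
size-element f Fin.zero    = m≤n⇒m≤1+n (m≤m+n _ _)
size-element f (Fin.suc e) = m≤n⇒m≤1+n (≤-trans (size-element (f ∘ Fin.suc) e) (m≤n+m _ (size (f Fin.zero))))

size-bits : ∀ x → ℕᵇ.size x ≤ size ⌜ x ⌝ℕᵇ
size-bits ℕᵇ.zero  = z≤n
size-bits 2[1+ x ] = s≤s (≤-trans (size-bits x) (m≤n+m _ 3))
size-bits 1+[2 x ] = s≤s (≤-trans (size-bits x) (m≤n+m _ 1))

size-denominator : ∀ q → ℕᵇ.size (denominator q) ≤ size ⌜ q ⌝ℚ
size-denominator q = ≤-trans (size-bits (denominator q)) (m≤n⇒m≤1+n (m≤n+m _ (size ⌜ ↥ q ⌝ℤ)))

module PowerBounds {W : ℕ} (2≤W : 2 ≤ W) where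

  raise : ∀ {x j} k → x ≤ W ^ j → j ≤ k → x ≤ W ^ k
  raise k x≤ j≤k = ≤-trans x≤ (^-monoʳ-≤ W {{>-nonZero (≤-trans (s≤s z≤n) 2≤W)}} j≤k)

  -- As 2 ≤ W, an addition costs one more power, and every running time is bounded by a single power
  -- of W.
  plus : ∀ k {x y} → x ≤ W ^ k → y ≤ W ^ k → x + y ≤ W ^ suc k
  plus k {x} {y} x≤ y≤ = begin
    x + y             ≤⟨ +-mono-≤ x≤ y≤ ⟩
    W ^ k + W ^ k     ≡⟨ cong (_+_ (W ^ k)) (+-identityʳ (W ^ k)) ⟨
    2 * W ^ k         ≤⟨ *-monoˡ-≤ (W ^ k) 2≤W ⟩
    W ^ suc k         ∎
    where open ≤-Reasoning

  times : ∀ j k {x y} → x ≤ W ^ j → y ≤ W ^ k → x * y ≤ W ^ (j + k)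
  times j k x≤ y≤ = ≤-trans (*-mono-≤ x≤ y≤) (≤-reflexive (sym (^-distribˡ-+-* W j k)))

^-distribʳ-* : ∀ a b k → (a * b) ^ k ≡ a ^ k * b ^ k
^-distribʳ-* a b zero    = refl
^-distribʳ-* a b (suc k) = trans (cong (a * b *_) (^-distribʳ-* a b k)) (*-interchange a b (a ^ k) (b ^ k))

size-positive : ∀ u → 1 ≤ size u
size-positive nil        = ≤-refl
size-positive (cons _ _) = s≤s z≤n

-- Since s ≥ 1, the constant is absorbed: suc b + s ≤ (2 + b) s. The last summand only fits the
-- bound to the shape c s^d + c.
linear-power : ∀ b s k → 1 ≤ s → (suc b + s) ^ k ≤ (2 + b) ^ k * s ^ k + (2 + b) ^ k
linear-power b s k 1≤s = begin
  (suc b + s) ^ k                  ≤⟨ ^-monoˡ-≤ k (+-monoˡ-≤ s (≤-trans (≤-reflexive (sym (*-identityʳ (suc b)))) (*-monoʳ-≤ (suc b) 1≤s))) ⟩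
  (suc b * s + s) ^ k              ≡⟨ cong (_^ k) (+-comm (suc b * s) s) ⟩
  ((2 + b) * s) ^ k                ≡⟨ ^-distribʳ-* (2 + b) s k ⟩
  (2 + b) ^ k * s ^ k              ≤⟨ m≤m+n _ _ ⟩
  (2 + b) ^ k * s ^ k + (2 + b) ^ k ∎
  where open ≤-Reasoning

module _ {n m : ℕ} (M : PartitionMatroid n m) {g : Fin n → ℚ} (cbgt : IsCBGT (independent? M) g)
  (D : ℕ) (maxSize≤D : maxSize ≤ D) (S≤D : size (encode M g) ≤ D) where

  private
    S W : ℕ
    S = size (encode M g)
    -- One more than D because a rotor of depth D takes D + 1 activations, and `Short` asks for two
    -- more than the number of digits.
    W = suc D

    maxSize≤W : maxSize ≤ W
    maxSize≤W = m≤n⇒m≤1+n maxSize≤D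

    blocks rates : Tree
    blocks = ⌜ tabulate (λ j → cons ⌜ block M j ⌝subset ⌜ capacity M j ⌝ℤ) ⌝list
    rates  = ⌜ tabulate (λ e → ⌜ g e ⌝ℚ) ⌝list

    blocks≤S : size blocks ≤ S
    blocks≤S = m≤n⇒m≤1+n (m≤m+n (size blocks) (size rates))

    rates<S : suc (size rates) ≤ S
    rates<S = s≤s (m≤n+m (size rates) (size blocks))

    n<W : suc n ≤ W
    n<W = ≤-trans (size-list _) (≤-trans (<⇒≤ rates<S) (m≤n⇒m≤1+n S≤D))

    m<D : suc m ≤ D
    m<D = ≤-trans (size-list _) (≤-trans blocks≤S S≤D)

    denominator<D : ∀ e → suc (ℕᵇ.size (denominator (g e))) ≤ D
    denominator<D e = ≤-trans (s≤s (≤-trans (size-denominator (g e)) (size-element (λ e → ⌜ g e ⌝ℚ) e)))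
                              (≤-trans rates<S S≤D)

    open Costs W maxSize≤W
    open PowerBounds {W} (≤-trans (s≤s (s≤s z≤n)) maxSize≤W)

    ts : List Rotor
    ts = rotors M cbgt

    depths : All (λ t → depth t ≤ D) ts
    depths = packAll-depth (block M) (level ∘ g) []
      (λ e eq → ≤-trans (ratioLevel-size (numerator (g e)) (denominator (g e)) eq) (denominator<D e)) []

    lengths : suc (length ts) ≤ W * W
    lengths = begin
      suc (length ts)        ≤⟨ s≤s (packAll-length (block M) (level ∘ g) []) ⟩
      suc (m * suc n + 0)    ≡⟨ cong suc (+-identityʳ (m * suc n)) ⟩
      suc (m * suc n)        ≤⟨ +-mono-≤ {1} (s≤s z≤n) (*-mono-≤ (<⇒≤ m<D) n<W) ⟩
      W + D * W              ∎
      where open ≤-Reasoning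

    W≤ : W ≤ W ^ 1
    W≤ = ≤-reflexive (sym (*-identityʳ W))

    WW+WW≤ : W * W + W * W ≤ W ^ 3
    WW+WW≤ = plus 2 (times 1 1 W≤ W≤) (times 1 1 W≤ W≤)

    costExp≤ : costExp ≤ W ^ 5
    costExp≤ = times 1 4 W≤ (plus 3 (raise 3 W≤ (s≤s z≤n)) WW+WW≤)

    costPack≤ : costPack ≤ W ^ 7
    costPack≤ = plus 6 (raise 6 W≤ (s≤s z≤n))
      (plus 5 costExp≤ (raise 5 (times 1 2 W≤ (plus 1 W≤ W≤)) (s≤s (s≤s (s≤s z≤n)))))

    costPackAll≤ : suc m * (W + suc n * costPack) ≤ W ^ 10
    costPackAll≤ = times 1 9 (≤-trans (m≤n⇒m≤1+n m<D) W≤)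
      (plus 8 (raise 8 W≤ (s≤s z≤n)) (times 1 7 (≤-trans n<W W≤) costPack≤))

    local≤ : ∀ k {s} → s ≤ maxSize → s ≤ W ^ suc k
    local≤ k s≤ = raise (suc k) (≤-trans s≤ (≤-trans maxSize≤W W≤)) (s≤s z≤n)

    state : ℕ → Tree
    state t = cons ⌜ ⊥ {n} ⌝subset ⌜ turns t ts ⌝rotors

    preprocess↓ : (encode M g ∷ []) ⊢ Algorithm.preprocess trimmer ↓ state 0
                    [ suc n * W + suc m * (W + suc n * costPack) ]
    preprocess↓ = cons-case↓ var↓ (cons↓
      (call↓ (var↓ ∷↓ []↓) (run-zeros (λ e → ⌜ g e ⌝ℚ)))
      (call↓ (var↓ ∷↓ var↓ ∷↓ nil↓ ∷↓ []↓)
        (run-packAll (block M) (λ j → ⌜ capacity M j ⌝ℤ) g [] (λ e → s≤s (denominator<D e)))))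

    next↓ : ∀ t → (state t ∷ []) ⊢ Algorithm.next trimmer ↓ cons ⌜ schedule {n} ts t ⌝subset (state (suc t))
                    [ suc (length (turns t ts)) * costCut + 0 ]
    next↓ t = cons-case↓ var↓ (let↓
      (call↓ (var↓ ∷↓ var↓ ∷↓ []↓)
        (run-cut (turns t ts) ⊥ n<W (All.map s≤s (turns-depth t depths))))
      (cons-case↓ var↓ (cons↓ var↓ (cons↓ var↓ var↓))))

  preprocess-bound : _⊢_↓_[_].total preprocess↓ ≤ W ^ 12
  preprocess-bound = ≤-trans (_⊢_↓_[_].total≤ preprocess↓)
    (plus 11 (local≤ 10 (toWitness {a? = ∥ Algorithm.preprocess trimmer ∥ ≤? maxSize} _))
      (plus 10 (raise 10 (times 1 1 (≤-trans n<W W≤) W≤) (s≤s (s≤s z≤n))) costPackAll≤))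

  next-bound : ∀ t → _⊢_↓_[_].total (next↓ t) ≤ W ^ 12
  next-bound t = raise 12 (≤-trans (_⊢_↓_[_].total≤ (next↓ t))
    (plus 6 (local≤ 5 (toWitness {a? = ∥ Algorithm.next trimmer ∥ ≤? maxSize} _))
      (≤-trans (≤-reflexive (+-identityʳ _)) (times 2 4 (≤-trans lengths′ (times 1 1 W≤ W≤)) (plus 3 (raise 3 W≤ (s≤s z≤n)) WW+WW≤)))))
    (m≤m+n 7 5)
    where
    lengths′ : suc (length (turns t ts)) ≤ W * W
    lengths′ = subst (λ l → suc l ≤ W * W) (sym (turns-length t ts)) lengths

  implementation : ∀ {b} → W ^ 12 ≤ b → Implements trimmer (encode M g) (schedule ts) b
  implementation W^12≤b = record
    { state      = state
    ; start      = _⊢_↓_[_].derivation preprocess↓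
    ; startBound = ≤-trans preprocess-bound W^12≤b
    ; step       = λ t → _⊢_↓_[_].derivation (next↓ t)
    ; stepBound  = λ t → ≤-trans (next-bound t) W^12≤b
    }

corollary4p6 : ∃[ A ] ∃[ c ] ∃[ d ]
    (∀ {n m : ℕ} (M : PartitionMatroid n m) (g : Fin n → ℚ) →
    IsCBGT (independent? M) g →
    ∃[ π ] (Valid (Independent M) π
    × HeightAtMost g π (+ 2 / 1)
    × Implements A (encode M g) π (c * size (encode M g) ^ d + c)))
-- Preprocessing dictates the exponent: packing all blocks stays within W^10, and two additions
-- raise this to W^12. A single day stays within W^7.
corollary4p6 = trimmer , (2 + maxSize) ^ 12 , 12 , λ M g cbgt →
  -- `ι 2` and `+ 2 / 1` agree by computation.
  schedule (rotors M cbgt) , schedule-valid M cbgt , schedule-height M cbgt ,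
  let s = size (encode M g) in
  implementation M cbgt (maxSize + s) (m≤m+n maxSize s) (m≤n+m s maxSize)
    (linear-power maxSize s 12 (size-positive (encode M g)))
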